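{- Suppose Alice is given a matroid $\mathcal{M}_1=(U,\mathcal{I}_1)$ and Bob is given a matroid $\mathcal{M}_2=(U,\mathcal{I}_2)$ on a common ground set $U$ with $|U|=n$. Any deterministic communication protocol between Alice and Bob that solves the matroid intersection problem (finding a maximum-size set in $\mathcal{I}_1\cap\mathcal{I}_2$) requires $\Omega(n\log n)$ bits of communication. -}

module Defs where

open import Data.Nat using (ℕ; zero; suc; _+_; _<_; _≤_)
open import Data.Bool using (Bool; true; false; T)
open import Data.Fin using (Fin)
open import Data.Fin.Subset using (Subset; ⊥; ⁅_⁆; _∪_; _∈_; _∉_; _⊆_; ∣_∣)
open import Data.Product using (Σ; ∃; _×_)

-- The ground set U with |U| = n is Fin n.
-- A set system on U is given by its (decidable) independence oracle.
Oracle : ℕ → Set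
Oracle n = Subset n → Bool

record IsMatroid {n : ℕ} (I : Oracle n) : Set where
  field
    empty-indep : T (I ⊥)
    hereditary  : ∀ A B → B ⊆ A → T (I A) → T (I B)
    exchange    : ∀ A B → T (I A) → T (I B) → ∣ A ∣ < ∣ B ∣ →
                  ∃ λ x → x ∈ B × x ∉ A × T (I (⁅ x ⁆ ∪ A))

IsMaxCommonIndep : {n : ℕ} → Oracle n → Oracle n → Subset n → Set
IsMaxCommonIndep I₁ I₂ S =
  T (I₁ S) × T (I₂ S) ×
  (∀ T' → T (I₁ T') → T (I₂ T') → ∣ T' ∣ ≤ ∣ S ∣)

-- Deterministic two-party protocol tree: Alice holds I₁, Bob holds I₂.
-- At an Alice node she sends one bit computed from her input; likewise Bob.
-- Leaves are labelled with the output set.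
data Protocol (n : ℕ) : Set where
  leaf  : Subset n → Protocol n
  alice : (Oracle n → Bool) → (onFalse onTrue : Protocol n) → Protocol n
  bob   : (Oracle n → Bool) → (onFalse onTrue : Protocol n) → Protocol n

run : {n : ℕ} → Protocol n → Oracle n → Oracle n → Subset n
run (leaf S)      I₁ I₂ = S
run (alice m f t) I₁ I₂ with m I₁
... | false = run f I₁ I₂
... | true  = run t I₁ I₂
run (bob m f t)   I₁ I₂ with m I₂
... | false = run f I₁ I₂
... | true  = run t I₁ I₂

cost : {n : ℕ} → Protocol n → Oracle n → Oracle n → ℕ
cost (leaf S)      I₁ I₂ = 0
cost (alice m f t) I₁ I₂ with m I₁
... | false = suc (cost f I₁ I₂)
... | true  = suc (cost t I₁ I₂)
cost (bob m f t)   I₁ I₂ with m I₂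
... | false = suc (cost f I₁ I₂)
... | true  = suc (cost t I₁ I₂)

Solves : {n : ℕ} → Protocol n → Set
Solves {n} P = ∀ (I₁ I₂ : Oracle n) → IsMatroid I₁ → IsMatroid I₂ →
               IsMaxCommonIndep I₁ I₂ (run P I₁ I₂)

{-# OPTIONS --safe #-}
module Submission where

-- Give every index i two parallel elements, of colour α i for Alice and β i for Bob, and let the capacity
-- of a colour be the number of indices carrying it, plus one at s (Alice) and at t (Bob).  By max-flow
-- min-cut, the two partition matroids have a common independent set larger than the number of indices iff
-- s and t are connected in the bipartite graph on colours whose edges are the indices.  This lets Alice hold
-- f : Fin k → Fin k, and Bob hold h : Fin k → Fin k and a set M of extra edges, with the answer telling
-- whether s ~ t in M ∪ {f a — h a}.  A protocol of cost d writes that 0/1 matrix as a sum of 2^d rank-one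
-- matrices.  Its rank is at least k^k: for a set W of vertices containing s and t,
--   Σ_{u ∈ W} [W separated in M + uv] = [W separated in M] + (|W| − 1) [W ∪ {v} separated in M],
-- so over ℚ the columns span the indicator of "all vertices are separated", which for M = ∅ is [f = h].
-- Characteristic zero matters: covers by 2^O(n) rectangles exist, so fooling sets cannot give n log n.

open import Defs
open import Data.Nat using (ℕ; _*_; _≤_)
open import Data.Nat.Logarithm using (⌊log₂_⌋)
open import Data.Product using (∃; _×_)

open import Data.Bool using (Bool; true; false; T; not; _∧_; _∨_; if_then_else_)
open import Data.Bool.Properties using (not-¬; ∧-zeroʳ)
open import Data.Empty using (⊥-elim)
open import Data.Fin using (Fin; zero; suc; _≟_; _↑ˡ_; _↑ʳ_; splitAt; punchIn; finToFun; funToFin; combine)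
open import Data.Fin.Properties using (all?; any?; punchInᵢ≢i; funToFin-finToFin; suc-injective)
open import Data.Fin.Subset using (Subset; ⊥; ⁅_⁆; _∪_; _∈_; _∉_; _⊆_; ∣_∣)
open import Data.Fin.Subset.Properties using (x∈⁅y⁆⇒x≡y; x∈p∪q⁻)
open import Data.Integer using (ℤ; 0ℤ; 1ℤ) renaming (+_ to pos; _+_ to _+ᶻ_; _*_ to _*ᶻ_; -_ to -ᶻ_)
import Data.Integer.Properties as ℤ
import Data.Integer.Solver as ℤ
open import Data.List using (List; []; _∷_; _++_; map; length; allFin)
import Data.List as List
open import Data.List.Membership.Propositional using (find) renaming (_∈_ to _∈ˡ_)
open import Data.List.Membership.Propositional.Properties using (∈-++⁺ˡ; ∈-++⁺ʳ; ∈-map⁺; ∈-allFin)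
open import Data.List.Properties using (length-map; length-++)
open import Data.List.Relation.Unary.All using (All; []; _∷_)
import Data.List.Relation.Unary.All as All
import Data.List.Relation.Unary.All.Properties as All
open import Data.List.Relation.Unary.AllPairs using (AllPairs; []; _∷_; allPairs?)
import Data.List.Relation.Unary.AllPairs as AllPairs
open import Data.List.Relation.Unary.Any using (here; there)
open import Data.List.Relation.Unary.Unique.Propositional using (Unique)
import Data.List.Relation.Unary.Unique.Propositional.Properties as Unique
open import Data.Nat using (zero; suc; _+_; _^_; _∸_; _<_; z≤n; s≤s; _≤?_; _<?_; ⌊_/2⌋; ⌈_/2⌉; NonZero; >-nonZero; pred)
open import Data.Nat.DivMod using (_/_; _%_; m≡m%n+[m/n]*n; m%n<n; /-monoˡ-≤)
open import Data.Nat.Induction using (<-rec)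
open import Data.Nat.Logarithm using (⌊log₂⌋-mono-≤; ⌊log₂⌊n/2⌋⌋≡⌊log₂n⌋∸1; ⌊log₂[2*b]⌋≡1+⌊log₂b⌋)
open import Data.Nat.Properties hiding (_≟_; suc-injective)
open import Data.Nat.Solver using (module +-*-Solver)
open import Data.Product using (_,_; proj₁; proj₂)
open import Data.Sum using (_⊎_; inj₁; inj₂)
open import Data.Sum.Properties using (≡-dec)
open import Data.Vec using ([]; _∷_; lookup; tabulate)
import Data.Vec as Vec
open import Data.Vec.Functional using (insertAt) renaming (_++_ to _++ᶠ_)
open import Data.Vec.Functional.Properties using (insertAt-lookup; insertAt-punchIn) renaming (lookup-++ˡ to lookup-++ᶠˡ; lookup-++ʳ to lookup-++ᶠʳ)
open import Data.Vec.Properties using (lookup-replicate; lookup∘tabulate; lookup-++ˡ; lookup-++ʳ; []=⇒lookup; lookup⇒[]=)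
open import Function using (_∘_; id)
open import Relation.Binary using (DecidableEquality)
open import Relation.Binary.PropositionalEquality using (_≡_; _≢_; _≗_; refl; sym; trans; cong; cong₂; subst; subst₂; module ≡-Reasoning)
open import Relation.Nullary using (Dec; yes; no; does; ¬_; ¬?; contradiction)
open import Relation.Nullary.Decidable using (⌊_⌋; toWitness; fromWitness; dec-true; dec-false; decidable-stable)
open import Algebra.Properties.Semiring.Sum +-*-semiring using (sum; sum-cong-≗; ∑-distrib-+; ∑-comm; *-distribˡ-sum; sum-replicate-zero)
import Algebra.Properties.Semiring.Sum ℤ.+-*-semiring as ∑ᶻ
open ∑ᶻ using () renaming (sum to sumᶻ)
open +-*-Solver using (solve; con; _:+_; _:*_; _:=_)
open ℤ.+-*-Solver using () renaming (solve to solveᶻ; con to conᶻ; _:+_ to _⊕_; _:*_ to _⊗_; :-_ to ⊖_; _:=_ to _⊜_)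

-- Indicators and finite sums

⟦_⟧ : Bool → ℕ
⟦ true ⟧  = 1
⟦ false ⟧ = 0

δ : ∀ {k} → Fin k → Fin k → ℕ
δ x y = ⟦ does (x ≟ y) ⟧

sum-mono-≤ : ∀ {n} {f g : Fin n → ℕ} → (∀ i → f i ≤ g i) → sum f ≤ sum g
sum-mono-≤ {zero}  f≤g = z≤n
sum-mono-≤ {suc n} f≤g = +-mono-≤ (f≤g zero) (sum-mono-≤ (f≤g ∘ suc))

sum-<⇒∃ : ∀ {n} (f g : Fin n → ℕ) → sum f < sum g → ∃ λ i → f i < g i
sum-<⇒∃ {suc n} f g Σf<Σg with f zero <? g zero
... | yes p = zero , p
... | no ¬p with sum-<⇒∃ (f ∘ suc) (g ∘ suc) (+-cancelˡ-< (f zero) _ _ (<-≤-trans Σf<Σg (+-monoˡ-≤ _ (≮⇒≥ ¬p))))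
...   | i , p = suc i , p

sum-δ : ∀ {k} (g : Fin k → ℕ) x → sum (λ c → g c * δ x c) ≡ g x
sum-δ {suc k} g zero = begin
  g zero * 1 + sum (λ c → g (suc c) * 0) ≡⟨ cong₂ _+_ (*-identityʳ (g zero)) (trans (sum-cong-≗ (*-zeroʳ ∘ g ∘ suc)) (sum-replicate-zero k)) ⟩
  g zero + 0                             ≡⟨ +-identityʳ _ ⟩
  g zero                                 ∎
  where open ≡-Reasoning
sum-δ {suc k} g (suc x) = cong₂ _+_ (*-zeroʳ (g zero)) (sum-δ (g ∘ suc) x)

-- Double counting: after the sums are exchanged, `e` survives only at its own colour `γ e`. With
-- `w` an indicator the inner sum is a `count`, so colour-weighted totals become sums over elements.
sum-fibres : ∀ {n k} (γ : Fin n → Fin k) (w : Fin n → ℕ) (g : Fin k → ℕ) →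
             sum (λ c → g c * sum (λ e → w e * δ (γ e) c)) ≡ sum (λ e → w e * g (γ e))
sum-fibres γ w g = begin
  sum (λ c → g c * sum (λ e → w e * δ (γ e) c))   ≡⟨ sum-cong-≗ (λ c → *-distribˡ-sum (g c) (λ e → w e * δ (γ e) c)) ⟩
  sum (λ c → sum (λ e → g c * (w e * δ (γ e) c))) ≡⟨ ∑-comm (λ c e → g c * (w e * δ (γ e) c)) ⟩
  sum (λ e → sum (λ c → g c * (w e * δ (γ e) c))) ≡⟨ sum-cong-≗ (λ e → sum-cong-≗ (λ c → swap (g c) (w e) (δ (γ e) c))) ⟩
  sum (λ e → sum (λ c → w e * (g c * δ (γ e) c))) ≡⟨ sum-cong-≗ (λ e → sym (*-distribˡ-sum (w e) (λ c → g c * δ (γ e) c))) ⟩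
  sum (λ e → w e * sum (λ c → g c * δ (γ e) c))   ≡⟨ sum-cong-≗ (λ e → cong (w e *_) (sum-δ g (γ e))) ⟩
  sum (λ e → w e * g (γ e))                       ∎
  where
  open ≡-Reasoning
  swap : ∀ a b c → a * (b * c) ≡ b * (a * c)
  swap = solve 3 (λ a b c → a :* (b :* c) := b :* (a :* c)) refl

sum-++ : ∀ m {n} (f : Fin (m + n) → ℕ) → sum f ≡ sum (f ∘ (_↑ˡ n)) + sum (f ∘ (m ↑ʳ_))
sum-++ zero    f = refl
sum-++ (suc m) f = trans (cong (f zero +_) (sum-++ m (f ∘ suc))) (sym (+-assoc (f zero) _ _))

sum-1 : ∀ n → sum {n} (λ _ → 1) ≡ n
sum-1 zero    = refl
sum-1 (suc n) = cong suc (sum-1 n)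

∣S∣≡sum : ∀ {n} (S : Subset n) → ∣ S ∣ ≡ sum (λ e → ⟦ lookup S e ⟧)
∣S∣≡sum []          = refl
∣S∣≡sum (true ∷ S)  = cong suc (∣S∣≡sum S)
∣S∣≡sum (false ∷ S) = ∣S∣≡sum S

-- Generalised partition matroids

count : ∀ {n k} → (Fin n → Fin k) → Subset n → Fin k → ℕ
count γ S c = sum (λ e → ⟦ lookup S e ⟧ * δ (γ e) c)

Within : ∀ {n k} → (Fin n → Fin k) → (Fin k → ℕ) → Subset n → Set
Within γ cap S = ∀ c → count γ S c ≤ cap c

partitionOracle : ∀ {n k} → (Fin n → Fin k) → (Fin k → ℕ) → Oracle n
partitionOracle γ cap S = ⌊ all? (λ c → count γ S c ≤? cap c) ⌋

module _ {n k : ℕ} (γ : Fin n → Fin k) where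

  sum-count : ∀ S → sum (count γ S) ≡ ∣ S ∣
  sum-count S = begin
    sum (count γ S)                    ≡⟨ sum-cong-≗ (λ c → sym (*-identityˡ (count γ S c))) ⟩
    sum (λ c → 1 * count γ S c)        ≡⟨ sum-fibres γ (λ e → ⟦ lookup S e ⟧) (λ _ → 1) ⟩
    sum (λ e → ⟦ lookup S e ⟧ * 1)     ≡⟨ sum-cong-≗ (λ e → *-identityʳ ⟦ lookup S e ⟧) ⟩
    sum (λ e → ⟦ lookup S e ⟧)         ≡⟨ ∣S∣≡sum S ⟨
    ∣ S ∣                              ∎
    where open ≡-Reasoning

  count-⊥ : ∀ c → count γ ⊥ c ≡ 0
  count-⊥ c = trans (sum-cong-≗ (λ e → cong (λ b → ⟦ b ⟧ * δ (γ e) c) (lookup-replicate e false))) (sum-replicate-zero n)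

  count-mono : ∀ {A B} → B ⊆ A → ∀ c → count γ B c ≤ count γ A c
  count-mono {A} {B} B⊆A c = sum-mono-≤ (λ e → *-monoˡ-≤ (δ (γ e) c) (at e))
    where
    at : ∀ e → ⟦ lookup B e ⟧ ≤ ⟦ lookup A e ⟧
    at e with lookup B e in eq
    ... | false = z≤n
    ... | true rewrite []=⇒lookup (B⊆A (lookup⇒[]= e B eq)) = ≤-refl

  count-insert : ∀ x A c → count γ (⁅ x ⁆ ∪ A) c ≤ count γ A c + δ (γ x) c
  count-insert x A c = begin
    count γ (⁅ x ⁆ ∪ A) c                                            ≤⟨ sum-mono-≤ (λ e → *-monoˡ-≤ (δ (γ e) c) (at e)) ⟩
    sum (λ e → (⟦ lookup A e ⟧ + δ x e) * δ (γ e) c)                 ≡⟨ sum-cong-≗ (λ e → split ⟦ lookup A e ⟧ (δ x e) (δ (γ e) c)) ⟩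
    sum (λ e → ⟦ lookup A e ⟧ * δ (γ e) c + δ (γ e) c * δ x e)       ≡⟨ ∑-distrib-+ (λ e → ⟦ lookup A e ⟧ * δ (γ e) c) (λ e → δ (γ e) c * δ x e) ⟩
    count γ A c + sum (λ e → δ (γ e) c * δ x e)                      ≡⟨ cong (count γ A c +_) (sum-δ (λ e → δ (γ e) c) x) ⟩
    count γ A c + δ (γ x) c                                          ∎
    where
    open ≤-Reasoning
    split : ∀ a b c → (a + b) * c ≡ a * c + c * b
    split = solve 3 (λ a b c → (a :+ b) :* c := a :* c :+ c :* b) refl
    at : ∀ e → ⟦ lookup (⁅ x ⁆ ∪ A) e ⟧ ≤ ⟦ lookup A e ⟧ + δ x e
    at e with lookup (⁅ x ⁆ ∪ A) e in eq
    ... | false = z≤n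
    ... | true with x∈p∪q⁻ ⁅ x ⁆ A (lookup⇒[]= e _ eq)
    ...   | inj₂ e∈A rewrite []=⇒lookup e∈A = s≤s z≤n
    ...   | inj₁ e∈x rewrite x∈⁅y⁆⇒x≡y x e∈x | dec-true (x ≟ x) refl = m≤n+m 1 _

  partition-isMatroid : ∀ cap → IsMatroid (partitionOracle γ cap)
  partition-isMatroid cap = record
    { empty-indep = fromWitness (λ c → subst (_≤ cap c) (sym (count-⊥ c)) z≤n)
    ; hereditary  = λ A B B⊆A A-ind → fromWitness (λ c → ≤-trans (count-mono B⊆A c) (toWitness A-ind c))
    ; exchange    = exchange
    }
    where
    exchange : ∀ A B → T (partitionOracle γ cap A) → T (partitionOracle γ cap B) → ∣ A ∣ < ∣ B ∣ →
               ∃ λ x → x ∈ B × x ∉ A × T (partitionOracle γ cap (⁅ x ⁆ ∪ A))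
    exchange A B A-ind B-ind A<B
      with sum-<⇒∃ (count γ A) (count γ B) (subst₂ _<_ (sym (sum-count A)) (sym (sum-count B)) A<B)
    -- The same pigeonhole is used twice: `c` is a colour more frequent in `B` than in `A`, and `x`
    -- is then an element of that colour in `B` only. Inserting `x` raises the count of `c` alone,
    -- where `A` is still below the capacity that `B` obeys.
    ... | c , Ac<Bc with sum-<⇒∃ _ _ Ac<Bc
    ...   | x , lt with lookup A x in A-x | lookup B x in B-x | γ x ≟ c
    ...     | true  | true | yes _    = ⊥-elim (<-irrefl refl lt)
    ...     | false | true | yes γx≡c = x , lookup⇒[]= x B B-x , x∉A , fromWitness within
      where
      x∉A : x ∉ A
      x∉A x∈A with () ← trans (sym A-x) ([]=⇒lookup x∈A)
      within : Within γ cap (⁅ x ⁆ ∪ A)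
      within c′ with γ x ≟ c′ | count-insert x A c′
      ... | no _     | le = ≤-trans le (subst (_≤ cap c′) (sym (+-identityʳ _)) (toWitness A-ind c′))
      ... | yes refl | le = ≤-trans le (subst (_≤ cap c′) (+-comm 1 _) (≤-trans (subst (λ z → count γ A z < count γ B z) (sym γx≡c) Ac<Bc) (toWitness B-ind c′)))

-- Each `e ∈ S` is charged to one side only: to its `γ₁`-colour if its label is false, to its
-- `γ₂`-colour if it is true. The total charged to a colour is at most its capacity.
weak-duality : ∀ {n k} (γ₁ γ₂ : Fin n → Fin k) (cap₁ cap₂ : Fin k → ℕ) (χ₁ χ₂ : Fin k → Bool) →
               (∀ e → χ₁ (γ₁ e) ≡ χ₂ (γ₂ e)) → ∀ S → Within γ₁ cap₁ S → Within γ₂ cap₂ S →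
               ∣ S ∣ ≤ sum (λ c → ⟦ not (χ₁ c) ⟧ * cap₁ c) + sum (λ c → ⟦ χ₂ c ⟧ * cap₂ c)
weak-duality γ₁ γ₂ cap₁ cap₂ χ₁ χ₂ χ-cut S S∈₁ S∈₂ = begin
  ∣ S ∣                                                                                     ≡⟨ ∣S∣≡sum S ⟩
  sum (λ e → ⟦ lookup S e ⟧)                                                                ≡⟨ sum-cong-≗ at ⟩
  sum (λ e → ⟦ lookup S e ⟧ * ⟦ not (χ₁ (γ₁ e)) ⟧ + ⟦ lookup S e ⟧ * ⟦ χ₂ (γ₂ e) ⟧)         ≡⟨ ∑-distrib-+ (λ e → ⟦ lookup S e ⟧ * ⟦ not (χ₁ (γ₁ e)) ⟧) (λ e → ⟦ lookup S e ⟧ * ⟦ χ₂ (γ₂ e) ⟧) ⟩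
  sum (λ e → ⟦ lookup S e ⟧ * ⟦ not (χ₁ (γ₁ e)) ⟧) + sum (λ e → ⟦ lookup S e ⟧ * ⟦ χ₂ (γ₂ e) ⟧)
    ≡⟨ cong₂ _+_ (sum-fibres γ₁ (λ e → ⟦ lookup S e ⟧) (λ c → ⟦ not (χ₁ c) ⟧)) (sum-fibres γ₂ (λ e → ⟦ lookup S e ⟧) (λ c → ⟦ χ₂ c ⟧)) ⟨
  sum (λ c → ⟦ not (χ₁ c) ⟧ * count γ₁ S c) + sum (λ c → ⟦ χ₂ c ⟧ * count γ₂ S c)
    ≤⟨ +-mono-≤ (sum-mono-≤ (λ c → *-monoʳ-≤ ⟦ not (χ₁ c) ⟧ (S∈₁ c))) (sum-mono-≤ (λ c → *-monoʳ-≤ ⟦ χ₂ c ⟧ (S∈₂ c))) ⟩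
  sum (λ c → ⟦ not (χ₁ c) ⟧ * cap₁ c) + sum (λ c → ⟦ χ₂ c ⟧ * cap₂ c)                       ∎
  where
  open ≤-Reasoning
  at : ∀ e → ⟦ lookup S e ⟧ ≡ ⟦ lookup S e ⟧ * ⟦ not (χ₁ (γ₁ e)) ⟧ + ⟦ lookup S e ⟧ * ⟦ χ₂ (γ₂ e) ⟧
  at e rewrite χ-cut e with lookup S e | χ₂ (γ₂ e)
  ... | true  | true  = refl
  ... | true  | false = refl
  ... | false | true  = refl
  ... | false | false = refl

-- Unit flows in undirected graphs

module _ {V : Set} (_≟ᵥ_ : DecidableEquality V) where

  Δ : V → V → ℕ
  Δ x y = ⟦ does (x ≟ᵥ y) ⟧

  -- The pair says which of the two elements of an edge are chosen; both means one unit of flow from p to q,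
  -- none one unit from q to p.  Subtraction-free: each edge contributes 2 to its ends, split evenly at zero flow.
  load : Bool × Bool → V → V → V → ℕ
  load (a , b) p q x = (⟦ a ⟧ + ⟦ b ⟧) * Δ p x + (⟦ not a ⟧ + ⟦ not b ⟧) * Δ q x

  IsCut : ∀ {m} → (p q : Fin m → V) → V → V → (V → Bool) → Set
  IsCut p q s t χ = (∀ i → χ (p i) ≡ χ (q i)) × χ s ≡ true × χ t ≡ false

  -- Conservation without subtraction: load minus degree is the net outflow at `x`, which has to be
  -- `Δ s x` minus `Δ t x`.
  IsFlow : ∀ {m} → (p q : Fin m → V) → V → V → (Fin m → Bool × Bool) → Set
  IsFlow p q s t w = ∀ x → sum (λ i → load (w i) (p i) (q i) x) + Δ t x ≡ sum (λ i → Δ (p i) x + Δ (q i) x) + Δ s x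

  Δ-separated : (χ : V → Bool) → ∀ {x y a} → χ x ≡ a → χ y ≡ not a → Δ x y ≡ 0
  Δ-separated χ {x} {y} χx χy = cong ⟦_⟧ (dec-false (x ≟ᵥ y) λ x≡y → not-¬ χx (trans (cong χ x≡y) χy))

  load-separated : (χ : V → Bool) → ∀ {p q x a} → χ p ≡ χ q → χ p ≡ a → χ x ≡ not a → ∀ w → load w p q x ≡ 0
  load-separated χ {p} {q} {x} χp≡χq χp χx (a , b)
    rewrite Δ-separated χ χp χx | Δ-separated χ {q} (trans (sym χp≡χq) χp) χx
    = cong₂ _+_ (*-zeroʳ (⟦ a ⟧ + ⟦ b ⟧)) (*-zeroʳ (⟦ not a ⟧ + ⟦ not b ⟧))

  glue : ∀ {m} → (Fin m → Bool) → (w₁ w₂ : Fin m → Bool × Bool) → Fin m → Bool × Bool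
  glue side w₁ w₂ i = if side i then w₁ i else w₂ i

  module _ {m : ℕ} {p q : Fin m → V} {χ : V → Bool} (χ-cut : ∀ i → χ (p i) ≡ χ (q i)) (w₁ w₂ : Fin m → Bool × Bool) where

    glue-inside : ∀ {x} → χ x ≡ true →
                  sum (λ i → load (glue (χ ∘ p) w₁ w₂ i) (p i) (q i) x) ≡ sum (λ i → load (w₁ i) (p i) (q i) x)
    glue-inside {x} χx = sum-cong-≗ at
      where
      at : ∀ i → load (glue (χ ∘ p) w₁ w₂ i) (p i) (q i) x ≡ load (w₁ i) (p i) (q i) x
      at i with χ (p i) in eq
      ... | true  = refl
      ... | false = trans (load-separated χ (χ-cut i) eq χx (w₂ i)) (sym (load-separated χ (χ-cut i) eq χx (w₁ i)))

    glue-outside : ∀ {x} → χ x ≡ false →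
                   sum (λ i → load (glue (χ ∘ p) w₁ w₂ i) (p i) (q i) x) ≡ sum (λ i → load (w₂ i) (p i) (q i) x)
    glue-outside {x} χx = sum-cong-≗ at
      where
      at : ∀ i → load (glue (χ ∘ p) w₁ w₂ i) (p i) (q i) x ≡ load (w₂ i) (p i) (q i) x
      at i with χ (p i) in eq
      ... | false = refl
      ... | true  = trans (load-separated χ (χ-cut i) eq χx (w₁ i)) (sym (load-separated χ (χ-cut i) eq χx (w₂ i)))

  -- A flow for the graph with one more edge, all of whose capacity is used from u to v.
  IsFlowThrough : ∀ {m} → V → V → (p q : Fin m → V) → V → V → (Fin m → Bool × Bool) → Set
  IsFlowThrough u v p q s t w =
    ∀ x → (2 * Δ u x + sum (λ i → load (w i) (p i) (q i) x)) + Δ t x ≡ (Δ u x + Δ v x + sum (λ i → Δ (p i) x + Δ (q i) x)) + Δ s x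

  module _ {m : ℕ} {p q : Fin m → V} {s t u v : V} {χ : V → Bool}
           (χ-cut : ∀ i → χ (p i) ≡ χ (q i)) (χs : χ s ≡ true) (χt : χ t ≡ false) (χu : χ u ≡ true) (χv : χ v ≡ false) where

    -- A flow s → u and a flow v → t may overlap, but masking them with the two sides of the cut makes them disjoint.
    bridge : ∀ {w₁ w₂} → IsFlow p q s u w₁ → IsFlow p q v t w₂ → IsFlowThrough u v p q s t (glue (χ ∘ p) w₁ w₂)
    bridge {w₁} {w₂} flow₁ flow₂ x with χ x in χx
    ... | true  rewrite glue-inside {p = p} {q} {χ} χ-cut w₁ w₂ χx | Δ-separated χ χv χx | Δ-separated χ χt χx =
      begin
        (2 * Δ u x + G) + 0       ≡⟨ solve 2 (λ u G → (con 2 :* u :+ G) :+ con 0 := u :+ (G :+ u)) refl (Δ u x) G ⟩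
        Δ u x + (G + Δ u x)       ≡⟨ cong (Δ u x +_) (flow₁ x) ⟩
        Δ u x + (D + Δ s x)       ≡⟨ solve 3 (λ u D s → u :+ (D :+ s) := (u :+ con 0 :+ D) :+ s) refl (Δ u x) D (Δ s x) ⟩
        (Δ u x + 0 + D) + Δ s x   ∎
      where
      open ≡-Reasoning
      G = sum (λ i → load (w₁ i) (p i) (q i) x)
      D = sum (λ i → Δ (p i) x + Δ (q i) x)
    ... | false rewrite glue-outside {p = p} {q} {χ} χ-cut w₁ w₂ χx | Δ-separated χ χu χx | Δ-separated χ χs χx =
      trans (flow₂ x) (solve 2 (λ v D → D :+ v := (v :+ D) :+ con 0) refl (Δ v x) (sum (λ i → Δ (p i) x + Δ (q i) x)))

    -- Here `χ` separates `s` and `u` from `v` and `t`. If `u` can be cut off from `s`, intersecting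
    -- with `χ` puts both ends of the new edge outside; if `t` can be cut off from `v`, a union puts
    -- both inside. Otherwise a unit goes from `s` to `u`, over the new edge, and from `v` to `t`.
    crossing : ∃ (IsCut p q s u) ⊎ ∃ (IsFlow p q s u) → ∃ (IsCut p q v t) ⊎ ∃ (IsFlow p q v t) →
               (∃ λ χ′ → χ′ u ≡ χ′ v × IsCut p q s t χ′) ⊎ ∃ (IsFlowThrough u v p q s t)
    crossing (inj₁ (χ′ , χ′-cut , χ′s , χ′u)) _ = inj₁
      ((λ x → χ x ∧ χ′ x) , trans (cong₂ _∧_ χu χ′u) (cong (_∧ χ′ v) (sym χv))
      , (λ i → cong₂ _∧_ (χ-cut i) (χ′-cut i)) , cong₂ _∧_ χs χ′s , cong (_∧ χ′ t) χt)
    crossing _ (inj₁ (χ′ , χ′-cut , χ′v , χ′t)) = inj₁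
      ((λ x → χ x ∨ χ′ x) , trans (cong (_∨ χ′ u) χu) (sym (cong₂ _∨_ χv χ′v))
      , (λ i → cong₂ _∨_ (χ-cut i) (χ′-cut i)) , cong (_∨ χ′ s) χs , cong₂ _∨_ χt χ′t)
    crossing (inj₂ (w₁ , flow₁)) (inj₂ (w₂ , flow₂)) = inj₂ (glue (χ ∘ p) w₁ w₂ , bridge {w₁} {w₂} flow₁ flow₂)

  extend : ∀ {m} → Bool × Bool → (Fin m → Bool × Bool) → Fin (suc m) → Bool × Bool
  extend a w zero    = a
  extend a w (suc i) = w i

  -- Max-flow min-cut for value one, by induction on the edges. Only a new edge that crosses the cut
  -- of the remaining graph needs work; the induction hypothesis is then used twice more, from `s`
  -- to the near end and from the far end to `t`.
  flow-or-cut : ∀ {m} (p q : Fin m → V) s t → ∃ (IsCut p q s t) ⊎ ∃ (IsFlow p q s t)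
  flow-or-cut {zero} p q s t with s ≟ᵥ t
  ... | yes refl = inj₂ ((λ ()) , λ x → refl)
  ... | no s≢t   = inj₁ ((λ x → does (s ≟ᵥ x)) , (λ ()) , dec-true (s ≟ᵥ s) refl , dec-false (s ≟ᵥ t) s≢t)
  flow-or-cut {suc m} p q s t with flow-or-cut (p ∘ suc) (q ∘ suc) s t
  -- `(true , false)` is zero flow: it loads each end by one, just what the new edge adds to the
  -- degrees.
  ... | inj₂ (w , flow) = inj₂ (extend (true , false) w , λ x → unused (Δ (p zero) x) (Δ (q zero) x) _ _ _ _ (flow x))
    where
    unused : ∀ u v G D s t → G + t ≡ D + s → (1 * u + 1 * v + G) + t ≡ (u + v + D) + s
    unused u v G D s t h = begin
      (1 * u + 1 * v + G) + t ≡⟨ solve 4 (λ u v G t → (con 1 :* u :+ con 1 :* v :+ G) :+ t := u :+ v :+ (G :+ t)) refl u v G t ⟩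
      u + v + (G + t)         ≡⟨ cong (u + v +_) h ⟩
      u + v + (D + s)         ≡⟨ +-assoc (u + v) D s ⟨
      (u + v + D) + s         ∎
      where
      open ≡-Reasoning
  ... | inj₁ (χ , χ-cut , χs , χt) with χ (p zero) in χp | χ (q zero) in χq
  ...   | true  | true  = inj₁ (χ , (λ { zero → trans χp (sym χq) ; (suc i) → χ-cut i }) , χs , χt)
  ...   | false | false = inj₁ (χ , (λ { zero → trans χp (sym χq) ; (suc i) → χ-cut i }) , χs , χt)
  ...   | true  | false
    with crossing χ-cut χs χt χp χq (flow-or-cut (p ∘ suc) (q ∘ suc) s (p zero)) (flow-or-cut (p ∘ suc) (q ∘ suc) (q zero) t)
  ...     | inj₁ (χ′ , eq , χ′-cut , ends) = inj₁ (χ′ , (λ { zero → eq ; (suc i) → χ′-cut i }) , ends)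
  ...     | inj₂ (w , flow) = inj₂ (extend (true , true) w , λ x → trans
              (cong (λ z → z + sum (λ i → load (w i) (p (suc i)) (q (suc i)) x) + Δ t x) (+-identityʳ (2 * Δ (p zero) x)))
              (flow x))
  flow-or-cut {suc m} p q s t | inj₁ (χ , χ-cut , χs , χt) | false | true
    with crossing χ-cut χs χt χq χp (flow-or-cut (p ∘ suc) (q ∘ suc) s (q zero)) (flow-or-cut (p ∘ suc) (q ∘ suc) (p zero) t)
  ...     | inj₁ (χ′ , eq , χ′-cut , ends) = inj₁ (χ′ , (λ { zero → sym eq ; (suc i) → χ′-cut i }) , ends)
  -- The new edge is now traversed from `q zero` to `p zero`, so neither of its elements is chosen.
  ...     | inj₂ (w , flow) = inj₂ (extend (false , false) w , λ x → trans (flow x)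
              (cong (λ z → z + sum (λ i → Δ (p (suc i)) x + Δ (q (suc i)) x) + Δ s x) (+-comm (Δ (q zero) x) (Δ (p zero) x))))

-- Connected components

merge : ∀ {k} → (Fin k → Fin k) → Fin k → Fin k → Fin k → Fin k
merge c u v x = if does (c x ≟ c v) then c u else c x

-- comp E x is a representative of the component of x in the graph with edge list E.
comp : ∀ {k} → List (Fin k × Fin k) → Fin k → Fin k
comp []            = id
comp ((u , v) ∷ E) = merge (comp E) u v

module _ {k : ℕ} where

  Respects : {A : Set} → (Fin k → A) → List (Fin k × Fin k) → Set
  Respects g = All (λ e → g (proj₁ e) ≡ g (proj₂ e))

  -- A representative is reached along edges, so a label constant on edges is constant on
  -- components. This universal property of `comp` is applied to labels given by a cut, by a coarser
  -- `comp` and by the identity.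
  respects⇒comp : ∀ {A : Set} (g : Fin k → A) {E} → Respects g E → ∀ x → g (comp E x) ≡ g x
  respects⇒comp g []                           x = refl
  respects⇒comp g {(u , v) ∷ E} (gu≡gv ∷ resp) x with comp E x ≟ comp E v
  ... | no _  = respects⇒comp g resp x
  ... | yes e = begin
    g (comp E u) ≡⟨ respects⇒comp g resp u ⟩
    g u          ≡⟨ gu≡gv ⟩
    g v          ≡⟨ respects⇒comp g resp v ⟨
    g (comp E v) ≡⟨ cong g e ⟨
    g (comp E x) ≡⟨ respects⇒comp g resp x ⟩
    g x          ∎
    where open ≡-Reasoning

  merge-≡ : ∀ (c : Fin k → Fin k) u v {x y} → c x ≡ c y → merge c u v x ≡ merge c u v y
  merge-≡ c u v = cong (λ z → if does (z ≟ c v) then c u else z)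

  merge-joins : ∀ (c : Fin k → Fin k) u v → merge c u v u ≡ merge c u v v
  merge-joins c u v with c u ≟ c v | c v ≟ c v
  ... | yes _ | yes _ = refl
  ... | no _  | yes _ = refl
  ... | _     | no ¬e = ⊥-elim (¬e refl)

  comp-respects : ∀ E → Respects (comp E) E
  comp-respects []            = []
  comp-respects ((u , v) ∷ E) = merge-joins (comp E) u v ∷ All.map (merge-≡ (comp E) u v) (comp-respects E)

-- Matroids of coloured parallel elements

chosen : ∀ {m} r → (Fin m → Bool × Bool) → Subset (m + (m + r))
chosen r w = tabulate (proj₁ ∘ w) Vec.++ (tabulate (proj₂ ∘ w) Vec.++ ⊥)

-- Two parallel elements per index, and r loops, which get the colour zero.
module _ {k m : ℕ} (r : ℕ) where

  paint : (Fin m → Fin k) → Fin (m + (m + r)) → Fin (suc k)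
  paint α = (suc ∘ α) ++ᶠ ((suc ∘ α) ++ᶠ (λ _ → zero))

  cap : (Fin m → Fin k) → Fin k → Fin (suc k) → ℕ
  cap α s zero    = 0
  cap α s (suc c) = sum (λ i → δ (α i) c) + δ s c

  colourOracle : (Fin m → Fin k) → Fin k → Oracle (m + (m + r))
  colourOracle α s = partitionOracle (paint α) (cap α s)

  colourOracle-isMatroid : ∀ α s → IsMatroid (colourOracle α s)
  colourOracle-isMatroid α s = partition-isMatroid (paint α) (cap α s)

  sum-cap : ∀ α s (g : Fin k → ℕ) → sum (λ c → g c * cap α s (suc c)) ≡ sum (g ∘ α) + g s
  sum-cap α s g = begin
    sum (λ c → g c * (sum (λ i → δ (α i) c) + δ s c))
      ≡⟨ sum-cong-≗ (λ c → trans (cong (λ z → g c * (z + δ s c)) (sum-cong-≗ (λ i → sym (*-identityˡ (δ (α i) c))))) (*-distribˡ-+ (g c) _ (δ s c))) ⟩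
    sum (λ c → g c * sum (λ i → 1 * δ (α i) c) + g c * δ s c)
      ≡⟨ ∑-distrib-+ (λ c → g c * sum (λ i → 1 * δ (α i) c)) (λ c → g c * δ s c) ⟩
    sum (λ c → g c * sum (λ i → 1 * δ (α i) c)) + sum (λ c → g c * δ s c)
      ≡⟨ cong₂ _+_ (trans (sum-fibres α (λ _ → 1) g) (sum-cong-≗ (λ i → *-identityˡ (g (α i))))) (sum-δ g s) ⟩
    sum (g ∘ α) + g s ∎
    where open ≡-Reasoning

  lift : (Fin k → Bool) → Fin (suc k) → Bool
  lift χ zero    = false
  lift χ (suc c) = χ c

  -- In the bound of weak duality an index `i` pays through `α i` or through `β i`, never both, so
  -- the indices contribute `m`. The extra units at `s` and `t` lie on the sides that are not
  -- charged.
  cut⇒≤ : ∀ {α β : Fin m → Fin k} {s t} (χ₁ χ₂ : Fin k → Bool) →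
          (∀ i → χ₁ (α i) ≡ χ₂ (β i)) → χ₁ s ≡ true → χ₂ t ≡ false →
          ∀ S → T (colourOracle α s S) → T (colourOracle β t S) → ∣ S ∣ ≤ m
  cut⇒≤ {α} {β} {s} {t} χ₁ χ₂ χ-cut χs χt S S∈₁ S∈₂ = begin
    ∣ S ∣
      ≤⟨ weak-duality (paint α) (paint β) (cap α s) (cap β t) (lift χ₁) (lift χ₂) lift-cut S (toWitness S∈₁) (toWitness S∈₂) ⟩
    sum (λ c → ⟦ not (χ₁ c) ⟧ * cap α s (suc c)) + sum (λ c → ⟦ χ₂ c ⟧ * cap β t (suc c))
      ≡⟨ cong₂ _+_ (sum-cap α s (λ c → ⟦ not (χ₁ c) ⟧)) (sum-cap β t (λ c → ⟦ χ₂ c ⟧)) ⟩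
    (sum (λ i → ⟦ not (χ₁ (α i)) ⟧) + ⟦ not (χ₁ s) ⟧) + (sum (λ i → ⟦ χ₂ (β i) ⟧) + ⟦ χ₂ t ⟧)
      ≡⟨ cong₂ (λ a b → (sum (λ i → ⟦ not (χ₁ (α i)) ⟧) + ⟦ not a ⟧) + (sum (λ i → ⟦ χ₂ (β i) ⟧) + ⟦ b ⟧)) χs χt ⟩
    (sum (λ i → ⟦ not (χ₁ (α i)) ⟧) + 0) + (sum (λ i → ⟦ χ₂ (β i) ⟧) + 0)
      ≡⟨ cong₂ _+_ (+-identityʳ (sum (λ i → ⟦ not (χ₁ (α i)) ⟧))) (+-identityʳ (sum (λ i → ⟦ χ₂ (β i) ⟧))) ⟩
    sum (λ i → ⟦ not (χ₁ (α i)) ⟧) + sum (λ i → ⟦ χ₂ (β i) ⟧)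
      ≡⟨ ∑-distrib-+ (λ i → ⟦ not (χ₁ (α i)) ⟧) (λ i → ⟦ χ₂ (β i) ⟧) ⟨
    sum (λ i → ⟦ not (χ₁ (α i)) ⟧ + ⟦ χ₂ (β i) ⟧)
      ≡⟨ sum-cong-≗ (λ i → one (χ-cut i)) ⟩
    sum {m} (λ _ → 1)
      ≡⟨ sum-1 m ⟩
    m ∎
    where
    open ≤-Reasoning
    one : ∀ {a b} → a ≡ b → ⟦ not a ⟧ + ⟦ b ⟧ ≡ 1
    one {true}  refl = refl
    one {false} refl = refl
    lift-cut : ∀ e → lift χ₁ (paint α e) ≡ lift χ₂ (paint β e)
    lift-cut e with splitAt m e
    ... | inj₁ i = χ-cut i
    ... | inj₂ e′ with splitAt m e′
    ...   | inj₁ i = χ-cut i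
    ...   | inj₂ _ = refl

  sum-chosen : ∀ (α : Fin m → Fin k) w (g : Fin (suc k) → ℕ) →
               sum (λ e → ⟦ lookup (chosen r w) e ⟧ * g (paint α e)) ≡ sum (λ i → (⟦ proj₁ (w i) ⟧ + ⟦ proj₂ (w i) ⟧) * g (suc (α i)))
  sum-chosen α w g = begin
    sum F                                                              ≡⟨ sum-++ m F ⟩
    sum {m} (F ∘ (_↑ˡ (m + r))) + sum {m + r} (F ∘ (m ↑ʳ_))                        ≡⟨ cong (sum {m} (F ∘ (_↑ˡ (m + r))) +_) (sum-++ m (F ∘ (m ↑ʳ_))) ⟩
    sum {m} (F ∘ (_↑ˡ (m + r))) + (sum {m} (F ∘ (m ↑ʳ_) ∘ (_↑ˡ r)) + sum {r} (F ∘ (m ↑ʳ_) ∘ (m ↑ʳ_)))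
      ≡⟨ cong₂ _+_ (sum-cong-≗ first) (cong₂ _+_ (sum-cong-≗ second) (trans (sum-cong-≗ third) (sum-replicate-zero r))) ⟩
    sum (λ i → ⟦ proj₁ (w i) ⟧ * g (suc (α i))) + (sum (λ i → ⟦ proj₂ (w i) ⟧ * g (suc (α i))) + 0)
      ≡⟨ cong (sum (λ i → ⟦ proj₁ (w i) ⟧ * g (suc (α i))) +_) (+-identityʳ _) ⟩
    sum (λ i → ⟦ proj₁ (w i) ⟧ * g (suc (α i))) + sum (λ i → ⟦ proj₂ (w i) ⟧ * g (suc (α i)))
      ≡⟨ ∑-distrib-+ (λ i → ⟦ proj₁ (w i) ⟧ * g (suc (α i))) (λ i → ⟦ proj₂ (w i) ⟧ * g (suc (α i))) ⟨
    sum (λ i → ⟦ proj₁ (w i) ⟧ * g (suc (α i)) + ⟦ proj₂ (w i) ⟧ * g (suc (α i)))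
      ≡⟨ sum-cong-≗ (λ i → sym (*-distribʳ-+ (g (suc (α i))) ⟦ proj₁ (w i) ⟧ ⟦ proj₂ (w i) ⟧)) ⟩
    sum (λ i → (⟦ proj₁ (w i) ⟧ + ⟦ proj₂ (w i) ⟧) * g (suc (α i))) ∎
    where
    open ≡-Reasoning
    F : Fin (m + (m + r)) → ℕ
    F e = ⟦ lookup (chosen r w) e ⟧ * g (paint α e)
    xs = tabulate (proj₁ ∘ w)
    ys = tabulate (proj₂ ∘ w)
    rest : Fin (m + r) → Fin (suc k)
    rest = (suc ∘ α) ++ᶠ (λ _ → zero)
    first : ∀ i → F (i ↑ˡ (m + r)) ≡ ⟦ proj₁ (w i) ⟧ * g (suc (α i))
    first i = cong₂ (λ b c → ⟦ b ⟧ * g c)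
      (trans (lookup-++ˡ xs (ys Vec.++ ⊥) i) (lookup∘tabulate (proj₁ ∘ w) i))
      (lookup-++ᶠˡ (suc ∘ α) rest i)
    second : ∀ i → F (m ↑ʳ (i ↑ˡ r)) ≡ ⟦ proj₂ (w i) ⟧ * g (suc (α i))
    second i = cong₂ (λ b c → ⟦ b ⟧ * g c)
      (trans (lookup-++ʳ xs (ys Vec.++ ⊥) (i ↑ˡ r)) (trans (lookup-++ˡ ys ⊥ i) (lookup∘tabulate (proj₂ ∘ w) i)))
      (trans (lookup-++ᶠʳ (suc ∘ α) rest (i ↑ˡ r)) (lookup-++ᶠˡ (suc ∘ α) (λ _ → zero) i))
    third : ∀ j → F (m ↑ʳ (m ↑ʳ j)) ≡ 0
    third j = cong (λ b → ⟦ b ⟧ * g (paint α (m ↑ʳ (m ↑ʳ j))))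
      (trans (lookup-++ʳ xs (ys Vec.++ ⊥) (m ↑ʳ j)) (trans (lookup-++ʳ ys ⊥ j) (lookup-replicate j false)))

  Saturates : (Fin m → Fin k) → Fin k → (Fin m → Bool × Bool) → Set
  Saturates α s w = ∀ c → sum (λ i → (⟦ proj₁ (w i) ⟧ + ⟦ proj₂ (w i) ⟧) * δ (α i) c) ≡ sum (λ i → δ (α i) c) + δ s c

  count-chosen : ∀ α s w → Saturates α s w → ∀ c → count (paint α) (chosen r w) c ≡ cap α s c
  count-chosen α s w sat zero    = trans (sum-chosen α w (λ d → δ d zero))
    (trans (sum-cong-≗ (λ i → *-zeroʳ (⟦ proj₁ (w i) ⟧ + ⟦ proj₂ (w i) ⟧))) (sum-replicate-zero m))
  count-chosen α s w sat (suc c) = trans (sum-chosen α w (λ d → δ d (suc c))) (sat c)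

  chosen-independent : ∀ α s w → Saturates α s w → T (colourOracle α s (chosen r w))
  chosen-independent α s w sat = fromWitness (λ c → ≤-reflexive (count-chosen α s w sat c))

  ∣chosen∣ : ∀ α s w → Saturates α s w → ∣ chosen r w ∣ ≡ suc m
  ∣chosen∣ α s w sat = begin
    ∣ chosen r w ∣                              ≡⟨ sum-count (paint α) (chosen r w) ⟨
    sum (count (paint α) (chosen r w))          ≡⟨ sum-cong-≗ (count-chosen α s w sat) ⟩
    sum (λ c → cap α s (suc c))               ≡⟨ sum-cong-≗ (λ c → sym (*-identityˡ (cap α s (suc c)))) ⟩
    sum (λ c → 1 * cap α s (suc c))           ≡⟨ sum-cap α s (λ _ → 1) ⟩
    sum {m} (λ _ → 1) + 1                     ≡⟨ cong (_+ 1) (sum-1 m) ⟩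
    m + 1                                     ≡⟨ +-comm m 1 ⟩
    suc m                                     ∎
    where open ≡-Reasoning

  module _ (α β : Fin m → Fin k) (s t : Fin k) (w : Fin m → Bool × Bool)
           (flow : IsFlow (≡-dec _≟_ _≟_) (inj₁ ∘ α) (inj₂ ∘ β) (inj₁ s) (inj₂ t) w) where

    private
      w⁺ w⁻ : Fin m → ℕ
      w⁺ i = ⟦ proj₁ (w i) ⟧ + ⟦ proj₂ (w i) ⟧
      w⁻ i = ⟦ not (proj₁ (w i)) ⟧ + ⟦ not (proj₂ (w i)) ⟧

    -- At a left vertex only first endpoints matter, so the load is the number of chosen elements of
    -- that colour, and conservation is saturation.
    flow⇒saturates₁ : Saturates α s w
    flow⇒saturates₁ c = begin
      sum (λ i → w⁺ i * δ (α i) c)                   ≡⟨ sum-cong-≗ (λ i → sym (trans (cong (w⁺ i * δ (α i) c +_) (*-zeroʳ (w⁻ i))) (+-identityʳ _))) ⟩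
      sum (λ i → w⁺ i * δ (α i) c + w⁻ i * 0)        ≡⟨ +-identityʳ _ ⟨
      sum (λ i → w⁺ i * δ (α i) c + w⁻ i * 0) + 0    ≡⟨ flow (inj₁ c) ⟩
      sum (λ i → δ (α i) c + 0) + δ s c              ≡⟨ cong (_+ δ s c) (sum-cong-≗ (λ i → +-identityʳ (δ (α i) c))) ⟩
      sum (λ i → δ (α i) c) + δ s c                  ∎
      where open ≡-Reasoning

    -- At a right vertex the load counts unchosen elements, so conservation makes their number the
    -- degree minus `δ t d`. Each index has two elements, which leaves the degree plus `δ t d`
    -- chosen.
    flow⇒saturates₂ : Saturates β t w
    flow⇒saturates₂ d = +-cancelʳ-≡ (sum (λ i → w⁻ i * δ (β i) d)) _ _ (begin
      sum (λ i → w⁺ i * δ (β i) d) + sum (λ i → w⁻ i * δ (β i) d)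
        ≡⟨ ∑-distrib-+ (λ i → w⁺ i * δ (β i) d) (λ i → w⁻ i * δ (β i) d) ⟨
      sum (λ i → w⁺ i * δ (β i) d + w⁻ i * δ (β i) d)
        ≡⟨ sum-cong-≗ (λ i → double (proj₁ (w i)) (proj₂ (w i)) (δ (β i) d)) ⟩
      sum (λ i → δ (β i) d + δ (β i) d)
        ≡⟨ ∑-distrib-+ (λ i → δ (β i) d) (λ i → δ (β i) d) ⟩
      b + b
        ≡⟨ cong (b +_) (trans (sym (+-identityʳ b)) (sym conserved)) ⟩
      b + (sum (λ i → w⁻ i * δ (β i) d) + δ t d)
        ≡⟨ solve 3 (λ b x y → b :+ (x :+ y) := b :+ y :+ x) refl b (sum (λ i → w⁻ i * δ (β i) d)) (δ t d) ⟩
      b + δ t d + sum (λ i → w⁻ i * δ (β i) d) ∎)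
      where
      open ≡-Reasoning
      b = sum (λ i → δ (β i) d)
      double : ∀ x y z → (⟦ x ⟧ + ⟦ y ⟧) * z + (⟦ not x ⟧ + ⟦ not y ⟧) * z ≡ z + z
      double true  true  = solve 1 (λ z → con 2 :* z :+ con 0 := z :+ z) refl
      double true  false = solve 1 (λ z → con 1 :* z :+ con 1 :* z := z :+ z) refl
      double false true  = solve 1 (λ z → con 1 :* z :+ con 1 :* z := z :+ z) refl
      double false false = solve 1 (λ z → con 2 :* z := z :+ z) refl
      conserved : sum (λ i → w⁻ i * δ (β i) d) + δ t d ≡ b + 0
      conserved = trans (cong (_+ δ t d) (sum-cong-≗ (λ i → sym (cong (_+ w⁻ i * δ (β i) d) (*-zeroʳ (w⁺ i)))))) (flow (inj₂ d))

-- Connectivity as matroid intersection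

graph : ∀ {k} → (f h : Fin k → Fin k) → List (Fin k × Fin k) → List (Fin k × Fin k)
graph f h M = M ++ List.tabulate (λ a → f a , h a)

module _ {k : ℕ} (r : ℕ) (s t : Fin k) where

  -- The `k + k` indices are edges of a bipartite graph in which Bob's colours stand for components
  -- of `M`. Edge `b` of the first half ties Alice's vertex `b` to its component `comp M b`; edge
  -- `a` of the second half joins `f a` to the component of `h a`. Contracting the first half
  -- recovers the connectivity of `graph f h M`.
  aliceOracle : (Fin k → Fin k) → Oracle ((k + k) + ((k + k) + r))
  aliceOracle f = colourOracle r (id ++ᶠ f) s

  bobOracle : (Fin k → Fin k) → List (Fin k × Fin k) → Oracle ((k + k) + ((k + k) + r))
  bobOracle h M = colourOracle r (comp M ++ᶠ (comp M ∘ h)) (comp M t)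

  module _ (f h : Fin k → Fin k) (M : List (Fin k × Fin k)) where

    private
      α = id ++ᶠ f
      β = comp M ++ᶠ (comp M ∘ h)
      E = graph f h M
      c = comp E

    c∘comp-M : ∀ x → c (comp M x) ≡ c x
    c∘comp-M = respects⇒comp c (All.++⁻ˡ M (comp-respects E))

    disconnected⇒≤ : ¬ c s ≡ c t → ∀ S → T (aliceOracle f S) → T (bobOracle h M S) → ∣ S ∣ ≤ k + k
    -- The component of `s` in `E` is the cut on both sides, since `x` and `comp M x` lie in the
    -- same component.
    disconnected⇒≤ cs≢ct = cut⇒≤ r {α} {β} {s} {comp M t} χ χ χ-cut (dec-true (c s ≟ c s) refl) (dec-false (c s ≟ c (comp M t)) (λ e → cs≢ct (trans e (c∘comp-M t))))
      where
      χ : Fin k → Bool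
      χ x = does (c s ≟ c x)
      χ-cut : ∀ i → χ ((id ++ᶠ f) i) ≡ χ ((comp M ++ᶠ (comp M ∘ h)) i)
      χ-cut i with splitAt k i
      ... | inj₁ b = cong (λ z → does (c s ≟ z)) (sym (c∘comp-M b))
      ... | inj₂ a = cong (λ z → does (c s ≟ z)) (trans (All.tabulate⁻ (All.++⁻ʳ M (comp-respects E)) a) (sym (c∘comp-M (h a))))

    connected⇒> : c s ≡ c t → ∃ λ S → T (aliceOracle f S) × T (bobOracle h M S) × k + k < ∣ S ∣
    connected⇒> cs≡ct with flow-or-cut (≡-dec _≟_ _≟_) (inj₁ ∘ α) (inj₂ ∘ β) (inj₁ s) (inj₂ (comp M t))
    ... | inj₂ (w , flow) = chosen r w
      , chosen-independent r α s w (flow⇒saturates₁ r α β s (comp M t) w flow)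
      , chosen-independent r β (comp M t) w (flow⇒saturates₂ r α β s (comp M t) w flow)
      , ≤-reflexive (sym (∣chosen∣ r α s w (flow⇒saturates₁ r α β s (comp M t) w flow)))
    -- No cut exists: by the first `k` edges the left label of `b` is the right label of its
    -- `M`-component. Hence `χ ∘ inj₁` is constant along `E`, and the connected `s` and `t` would
    -- get equal labels.
    ... | inj₁ (χ , χ-cut , χs , χt) = contradiction (trans (sym χs) (trans χs≡χt χt)) λ ()
      where
      at-B : ∀ b → χ (inj₁ b) ≡ χ (inj₂ (comp M b))
      at-B b = trans (cong (χ ∘ inj₁) (sym (lookup-++ᶠˡ id f b)))
        (trans (χ-cut (b ↑ˡ k)) (cong (χ ∘ inj₂) (lookup-++ᶠˡ (comp M) (comp M ∘ h) b)))
      at-A : ∀ a → χ (inj₁ (f a)) ≡ χ (inj₂ (comp M (h a)))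
      at-A a = trans (cong (χ ∘ inj₁) (sym (lookup-++ᶠʳ id f a)))
        (trans (χ-cut (k ↑ʳ a)) (cong (χ ∘ inj₂) (lookup-++ᶠʳ (comp M) (comp M ∘ h) a)))
      resp : Respects (χ ∘ inj₁) E
      resp = All.++⁺
        (All.map (λ {e} eq → trans (at-B (proj₁ e)) (trans (cong (χ ∘ inj₂) eq) (sym (at-B (proj₂ e))))) (comp-respects M))
        (All.tabulate⁺ (λ a → trans (at-A a) (sym (at-B (h a)))))
      χs≡χt : χ (inj₁ s) ≡ χ (inj₂ (comp M t))
      χs≡χt = trans (sym (respects⇒comp (χ ∘ inj₁) resp s)) (trans (cong (χ ∘ inj₁) cs≡ct)
        (trans (respects⇒comp (χ ∘ inj₁) resp t) (at-B t)))

-- Linear algebra over ℤ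

dot : ∀ {N} → (Fin N → ℤ) → (Fin N → ℤ) → ℤ
dot x a = sumᶻ (λ j → x j *ᶻ a j)

sumᶻ-zero : ∀ {N} {g : Fin N → ℤ} → (∀ j → g j ≡ 0ℤ) → sumᶻ g ≡ 0ℤ
sumᶻ-zero {N} g≡0 = trans (∑ᶻ.sum-cong-≗ g≡0) (∑ᶻ.sum-replicate-zero N)

dot-zeroʳ : ∀ {N} (x : Fin N → ℤ) {a} → (∀ j → a j ≡ 0ℤ) → dot x a ≡ 0ℤ
dot-zeroʳ x a≡0 = sumᶻ-zero (λ j → trans (cong (x j *ᶻ_) (a≡0 j)) (ℤ.*-zeroʳ (x j)))

dot-cong : ∀ {N} (x : Fin N → ℤ) {a b} → a ≗ b → dot x a ≡ dot x b
dot-cong x a≗b = ∑ᶻ.sum-cong-≗ (λ j → cong (x j *ᶻ_) (a≗b j))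

dot-+ : ∀ {N} (x : Fin N → ℤ) a b → dot x (λ j → a j +ᶻ b j) ≡ dot x a +ᶻ dot x b
dot-+ x a b = trans (∑ᶻ.sum-cong-≗ (λ j → ℤ.*-distribˡ-+ (x j) (a j) (b j))) (∑ᶻ.∑-distrib-+ (λ j → x j *ᶻ a j) (λ j → x j *ᶻ b j))

dot-*ʳ : ∀ {N} (x : Fin N → ℤ) a z → dot x (λ j → a j *ᶻ z) ≡ dot x a *ᶻ z
dot-*ʳ x a z = trans (∑ᶻ.sum-cong-≗ (λ j → sym (ℤ.*-assoc (x j) (a j) z))) (sym (∑ᶻ.*-distribʳ-sum z (λ j → x j *ᶻ a j)))

-- Fraction-free Gaussian elimination: cross-multiplying with the pivot `a p` removes the unknown
-- `p` from `b` without leaving ℤ.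
eliminate : ∀ {N} → (Fin (suc N) → ℤ) → Fin (suc N) → (Fin (suc N) → ℤ) → Fin N → ℤ
eliminate a p b j = b (punchIn p j) *ᶻ a p +ᶻ a (punchIn p j) *ᶻ (-ᶻ b p)

-- The other unknowns are scaled by the pivot, so that the value at `p` forced by `a` is an integer.
lift-solution : ∀ {N} → (Fin (suc N) → ℤ) → Fin (suc N) → (Fin N → ℤ) → Fin (suc N) → ℤ
lift-solution a p y = insertAt (λ j → y j *ᶻ a p) p (-ᶻ dot y (a ∘ punchIn p))

dot-lift-solution : ∀ {N} a p (y : Fin N → ℤ) b → dot (lift-solution a p y) b ≡ dot y (eliminate a p b)
dot-lift-solution a p y b = begin
  dot x b                                                             ≡⟨ ∑ᶻ.sum-remove {i = p} (λ j → x j *ᶻ b j) ⟩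
  x p *ᶻ b p +ᶻ sumᶻ (λ j → x (punchIn p j) *ᶻ b (punchIn p j))
    ≡⟨ cong₂ _+ᶻ_ (cong (_*ᶻ b p) (insertAt-lookup y′ p _))
                  (∑ᶻ.sum-cong-≗ (λ j → trans (cong (_*ᶻ b (punchIn p j)) (insertAt-punchIn y′ p _ j)) (rearrange (y j) (a p) (b (punchIn p j))))) ⟩
  (-ᶻ dot y a′) *ᶻ b p +ᶻ dot y (λ j → b (punchIn p j) *ᶻ a p)        ≡⟨ cong (_+ᶻ dot y (λ j → b (punchIn p j) *ᶻ a p)) (sign (dot y a′) (b p)) ⟩
  dot y a′ *ᶻ (-ᶻ b p) +ᶻ dot y (λ j → b (punchIn p j) *ᶻ a p)        ≡⟨ ℤ.+-comm (dot y a′ *ᶻ (-ᶻ b p)) _ ⟩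
  dot y (λ j → b (punchIn p j) *ᶻ a p) +ᶻ dot y a′ *ᶻ (-ᶻ b p)        ≡⟨ cong (dot y (λ j → b (punchIn p j) *ᶻ a p) +ᶻ_) (dot-*ʳ y a′ (-ᶻ b p)) ⟨
  dot y (λ j → b (punchIn p j) *ᶻ a p) +ᶻ dot y (λ j → a′ j *ᶻ (-ᶻ b p)) ≡⟨ dot-+ y (λ j → b (punchIn p j) *ᶻ a p) (λ j → a′ j *ᶻ (-ᶻ b p)) ⟨
  dot y (eliminate a p b)                                             ∎
  where
  open ≡-Reasoning
  x = lift-solution a p y
  a′ = a ∘ punchIn p
  y′ = λ j → y j *ᶻ a p
  rearrange : ∀ u v w → (u *ᶻ v) *ᶻ w ≡ u *ᶻ (w *ᶻ v)
  rearrange = solveᶻ 3 (λ u v w → (u ⊗ v) ⊗ w ⊜ u ⊗ (w ⊗ v)) refl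
  sign : ∀ u v → (-ᶻ u) *ᶻ v ≡ u *ᶻ (-ᶻ v)
  sign = solveᶻ 2 (λ u v → (⊖ u) ⊗ v ⊜ u ⊗ (⊖ v)) refl

kernel : ∀ {L N} (as : Fin L → Fin N → ℤ) → L < N →
         ∃ λ (x : Fin N → ℤ) → (∃ λ j → x j ≢ 0ℤ) × (∀ i → dot x (as i) ≡ 0ℤ)
kernel {zero}  {suc N} as _ = (λ _ → 1ℤ) , (zero , λ ()) , λ ()
kernel {suc L} {suc N} as (s≤s lt) with any? (λ j → ¬? (as zero j ℤ.≟ 0ℤ))
... | no a≡0 with kernel (as ∘ suc) (m<n⇒m<1+n lt)
...   | x , x≢0 , solves = x , x≢0 , λ where
        zero    → dot-zeroʳ x (λ j → decidable-stable (as zero j ℤ.≟ 0ℤ) (λ aj≢0 → a≡0 (j , aj≢0)))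
        (suc i) → solves i
kernel {suc L} {suc N} as (s≤s lt) | yes (p , ap≢0) with kernel (eliminate (as zero) p ∘ as ∘ suc) lt
...   | y , (j , yj≢0) , solves = lift-solution a p y , (punchIn p j , nonzero) , λ where
        zero    → trans (dot-lift-solution a p y a) (dot-zeroʳ y (λ i → cancel (a (punchIn p i)) (a p)))
        (suc i) → trans (dot-lift-solution a p y (as (suc i))) (solves i)
  where
  a = as zero
  cancel : ∀ u v → u *ᶻ v +ᶻ u *ᶻ (-ᶻ v) ≡ 0ℤ
  cancel = solveᶻ 2 (λ u v → u ⊗ v ⊕ u ⊗ (⊖ v) ⊜ conᶻ 0ℤ) refl
  -- Scaling by the nonzero pivot preserves a nonzero entry, as ℤ has no zero divisors.
  nonzero : lift-solution a p y (punchIn p j) ≢ 0ℤ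
  nonzero eq with ℤ.i*j≡0⇒i≡0∨j≡0 (y j) (trans (sym (insertAt-punchIn _ p _ j)) eq)
  ... | inj₁ e = yj≢0 e
  ... | inj₂ e = ap≢0 e

-- Rank-one decomposition of a protocol

ι : Bool → ℤ
ι b = pos ⟦ b ⟧

Terms : ℕ → Set
Terms n = List ((Oracle n → ℤ) × (Oracle n → ℤ))

module _ {n : ℕ} where

  eval : Terms n → Oracle n → Oracle n → ℤ
  eval []             I₁ I₂ = 0ℤ
  eval ((a , b) ∷ ts) I₁ I₂ = a I₁ *ᶻ b I₂ +ᶻ eval ts I₁ I₂

  scale₁ scale₂ : (Oracle n → ℤ) → Terms n → Terms n
  scale₁ g = map (λ t → (λ I → g I *ᶻ proj₁ t I) , proj₂ t)
  scale₂ g = map (λ t → proj₁ t , (λ I → g I *ᶻ proj₂ t I))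

  eval-++ : ∀ ts us I₁ I₂ → eval (ts ++ us) I₁ I₂ ≡ eval ts I₁ I₂ +ᶻ eval us I₁ I₂
  eval-++ []             us I₁ I₂ = sym (ℤ.+-identityˡ _)
  eval-++ ((a , b) ∷ ts) us I₁ I₂ = trans (cong (a I₁ *ᶻ b I₂ +ᶻ_) (eval-++ ts us I₁ I₂)) (sym (ℤ.+-assoc (a I₁ *ᶻ b I₂) _ _))

  eval-scale₁ : ∀ g ts I₁ I₂ → eval (scale₁ g ts) I₁ I₂ ≡ g I₁ *ᶻ eval ts I₁ I₂
  eval-scale₁ g []             I₁ I₂ = sym (ℤ.*-zeroʳ (g I₁))
  eval-scale₁ g ((a , b) ∷ ts) I₁ I₂ rewrite eval-scale₁ g ts I₁ I₂ =
    solveᶻ 4 (λ g a b e → (g ⊗ a) ⊗ b ⊕ g ⊗ e ⊜ g ⊗ (a ⊗ b ⊕ e)) refl (g I₁) (a I₁) (b I₂) (eval ts I₁ I₂)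

  eval-scale₂ : ∀ g ts I₁ I₂ → eval (scale₂ g ts) I₁ I₂ ≡ g I₂ *ᶻ eval ts I₁ I₂
  eval-scale₂ g []             I₁ I₂ = sym (ℤ.*-zeroʳ (g I₂))
  eval-scale₂ g ((a , b) ∷ ts) I₁ I₂ rewrite eval-scale₂ g ts I₁ I₂ =
    solveᶻ 4 (λ g a b e → a ⊗ (g ⊗ b) ⊕ g ⊗ e ⊜ g ⊗ (a ⊗ b ⊕ e)) refl (g I₂) (a I₁) (b I₂) (eval ts I₁ I₂)

  length-both : ∀ {A : Set} (φ ψ : A → A) xs ys {b} → length xs ≤ b → length ys ≤ b → length (map φ xs ++ map ψ ys) ≤ 2 * b
  length-both φ ψ xs ys {b} xs≤b ys≤b = begin
    length (map φ xs ++ map ψ ys)         ≡⟨ length-++ (map φ xs) ⟩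
    length (map φ xs) + length (map ψ ys) ≡⟨ cong₂ _+_ (length-map φ xs) (length-map ψ ys) ⟩
    length xs + length ys                 ≤⟨ +-mono-≤ xs≤b ys≤b ⟩
    b + b                                 ≡⟨ cong (_+_ b) (+-identityʳ b) ⟨
    2 * b                                 ∎
    where open ≤-Reasoning

  select-false : ∀ x y → 1ℤ *ᶻ x +ᶻ 0ℤ *ᶻ y ≡ x
  select-false = solveᶻ 2 (λ x y → conᶻ 1ℤ ⊗ x ⊕ conᶻ 0ℤ ⊗ y ⊜ x) refl

  select-true : ∀ x y → 0ℤ *ᶻ x +ᶻ 1ℤ *ᶻ y ≡ y
  select-true = solveᶻ 2 (λ x y → conᶻ 0ℤ ⊗ x ⊕ conᶻ 1ℤ ⊗ y ⊜ y) refl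

  module _ (val : Subset n → ℤ) where

    -- Branches deeper than the budget d are dropped, so only inputs of cost at most d are represented.
    terms : ℕ → Protocol n → Terms n
    terms d       (leaf S)      = ((λ _ → 1ℤ) , (λ _ → val S)) ∷ []
    terms zero    (alice m f t) = []
    terms zero    (bob m f t)   = []
    terms (suc d) (alice m f t) = scale₁ (ι ∘ not ∘ m) (terms d f) ++ scale₁ (ι ∘ m) (terms d t)
    terms (suc d) (bob m f t)   = scale₂ (ι ∘ not ∘ m) (terms d f) ++ scale₂ (ι ∘ m) (terms d t)

    length-terms : ∀ d P → length (terms d P) ≤ 2 ^ d
    length-terms d       (leaf S)      = m^n>0 2 d
    length-terms zero    (alice m f t) = z≤n
    length-terms zero    (bob m f t)   = z≤n
    length-terms (suc d) (alice m f t) = length-both _ _ (terms d f) (terms d t) (length-terms d f) (length-terms d t)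
    length-terms (suc d) (bob m f t)   = length-both _ _ (terms d f) (terms d t) (length-terms d f) (length-terms d t)

    -- At a node the two branches carry complementary indicators of the bit sent, so only the branch
    -- taken survives. Each indicator depends on the speaker's input alone and is absorbed into that
    -- party's factor, which keeps every term of rank one.
    eval-terms : ∀ d P I₁ I₂ → cost P I₁ I₂ ≤ d → eval (terms d P) I₁ I₂ ≡ val (run P I₁ I₂)
    eval-terms d (leaf S) I₁ I₂ _ = solveᶻ 1 (λ v → conᶻ 1ℤ ⊗ v ⊕ conᶻ 0ℤ ⊜ v) refl (val S)
    eval-terms zero (alice m f t) I₁ I₂ le with m I₁
    eval-terms zero (alice m f t) I₁ I₂ () | false
    eval-terms zero (alice m f t) I₁ I₂ () | true
    eval-terms zero (bob m f t) I₁ I₂ le with m I₂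
    eval-terms zero (bob m f t) I₁ I₂ () | false
    eval-terms zero (bob m f t) I₁ I₂ () | true
    eval-terms (suc d) (alice m f t) I₁ I₂ le = trans
      (trans (eval-++ (scale₁ (ι ∘ not ∘ m) (terms d f)) (scale₁ (ι ∘ m) (terms d t)) I₁ I₂)
             (cong₂ _+ᶻ_ (eval-scale₁ (ι ∘ not ∘ m) (terms d f) I₁ I₂) (eval-scale₁ (ι ∘ m) (terms d t) I₁ I₂)))
      (branch le)
      where
      branch : cost (alice m f t) I₁ I₂ ≤ suc d →
               ι (not (m I₁)) *ᶻ eval (terms d f) I₁ I₂ +ᶻ ι (m I₁) *ᶻ eval (terms d t) I₁ I₂ ≡ val (run (alice m f t) I₁ I₂)
      branch le with m I₁
      branch (s≤s le) | false = trans (select-false _ (eval (terms d t) I₁ I₂)) (eval-terms d f I₁ I₂ le)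
      branch (s≤s le) | true  = trans (select-true (eval (terms d f) I₁ I₂) _) (eval-terms d t I₁ I₂ le)
    eval-terms (suc d) (bob m f t) I₁ I₂ le = trans
      (trans (eval-++ (scale₂ (ι ∘ not ∘ m) (terms d f)) (scale₂ (ι ∘ m) (terms d t)) I₁ I₂)
             (cong₂ _+ᶻ_ (eval-scale₂ (ι ∘ not ∘ m) (terms d f) I₁ I₂) (eval-scale₂ (ι ∘ m) (terms d t) I₁ I₂)))
      (branch le)
      where
      branch : cost (bob m f t) I₁ I₂ ≤ suc d →
               ι (not (m I₂)) *ᶻ eval (terms d f) I₁ I₂ +ᶻ ι (m I₂) *ᶻ eval (terms d t) I₁ I₂ ≡ val (run (bob m f t) I₁ I₂)
      branch le with m I₂
      branch (s≤s le) | false = trans (select-false _ (eval (terms d t) I₁ I₂)) (eval-terms d f I₁ I₂ le)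
      branch (s≤s le) | true  = trans (select-true (eval (terms d f) I₁ I₂) _) (eval-terms d t I₁ I₂ le)

  -- For fixed `I₂` every factor of Bob is a scalar, so the column is a combination of Alice's
  -- factors, each orthogonal to `x`.
  dot-eval : ∀ {N} (x : Fin N → ℤ) (I : Fin N → Oracle n) ts → (∀ i → dot x (proj₁ (List.lookup ts i) ∘ I) ≡ 0ℤ) →
             ∀ I₂ → dot x (λ j → eval ts (I j) I₂) ≡ 0ℤ
  dot-eval x I []             _    I₂ = dot-zeroʳ x (λ _ → refl)
  dot-eval x I ((a , b) ∷ ts) x⊥ts I₂ = begin
    dot x (λ j → a (I j) *ᶻ b I₂ +ᶻ eval ts (I j) I₂)               ≡⟨ dot-+ x (λ j → a (I j) *ᶻ b I₂) (λ j → eval ts (I j) I₂) ⟩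
    dot x (λ j → a (I j) *ᶻ b I₂) +ᶻ dot x (λ j → eval ts (I j) I₂) ≡⟨ cong₂ _+ᶻ_ (trans (dot-*ʳ x (a ∘ I) (b I₂)) (cong (_*ᶻ b I₂) (x⊥ts zero))) (dot-eval x I ts (x⊥ts ∘ suc) I₂) ⟩
    0ℤ                                                              ∎
    where open ≡-Reasoning

-- Separation of vertex sets

InjOn : ∀ {k} → (Fin k → Fin k) → List (Fin k) → Set
InjOn c = AllPairs (λ x y → c x ≢ c y)

injOn? : ∀ {k} (c : Fin k → Fin k) W → Dec (InjOn c W)
injOn? c = allPairs? (λ x y → ¬? (c x ≟ c y))

injInd : ∀ {k} → (Fin k → Fin k) → List (Fin k) → ℤ
injInd c W = ι (does (injOn? c W))

Σᴸ : {A : Set} → List A → (A → ℤ) → ℤ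
Σᴸ []      g = 0ℤ
Σᴸ (u ∷ W) g = g u +ᶻ Σᴸ W g

Σᴸ-cong : ∀ {A : Set} W {g g′ : A → ℤ} → (∀ {u} → u ∈ˡ W → g u ≡ g′ u) → Σᴸ W g ≡ Σᴸ W g′
Σᴸ-cong []      eq = refl
Σᴸ-cong (u ∷ W) eq = cong₂ _+ᶻ_ (eq (here refl)) (Σᴸ-cong W (eq ∘ there))

Σᴸ-zero : ∀ {A : Set} W {g : A → ℤ} → (∀ {u} → u ∈ˡ W → g u ≡ 0ℤ) → Σᴸ W g ≡ 0ℤ
Σᴸ-zero []      eq = refl
Σᴸ-zero (u ∷ W) eq = cong₂ _+ᶻ_ (eq (here refl)) (Σᴸ-zero W (eq ∘ there))

Σᴸ-one : ∀ {A : Set} (W : List A) → Σᴸ W (λ _ → 1ℤ) ≡ pos (length W)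
Σᴸ-one []      = refl
Σᴸ-one (u ∷ W) = cong (1ℤ +ᶻ_) (Σᴸ-one W)

Σᴸ-≢0 : ∀ {A : Set} W (g : A → ℤ) → Σᴸ W g ≢ 0ℤ → ∃ λ u → g u ≢ 0ℤ
Σᴸ-≢0 []      g Σ≢0 = ⊥-elim (Σ≢0 refl)
Σᴸ-≢0 (u ∷ W) g Σ≢0 with g u ℤ.≟ 0ℤ
... | no gu≢0  = u , gu≢0
... | yes gu≡0 = Σᴸ-≢0 W g (λ Σ≡0 → Σ≢0 (cong₂ _+ᶻ_ gu≡0 Σ≡0))

dot-Σᴸ : ∀ {N} {A : Set} (x : Fin N → ℤ) W (g : A → Fin N → ℤ) →
         dot x (λ j → Σᴸ W (λ u → g u j)) ≡ Σᴸ W (λ u → dot x (g u))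
dot-Σᴸ x []      g = dot-zeroʳ x (λ _ → refl)
dot-Σᴸ x (u ∷ W) g = trans (dot-+ x (g u) (λ j → Σᴸ W (λ u → g u j))) (cong (dot x (g u) +ᶻ_) (dot-Σᴸ x W g))

module _ {k : ℕ} where

  injInd-yes : ∀ {c : Fin k → Fin k} {W} → InjOn c W → injInd c W ≡ 1ℤ
  injInd-yes {c} {W} inj = cong ι (dec-true (injOn? c W) inj)

  injInd-no : ∀ {c : Fin k → Fin k} {W} → ¬ InjOn c W → injInd c W ≡ 0ℤ
  injInd-no {c} {W} ¬inj = cong ι (dec-false (injOn? c W) ¬inj)

  injOn-coarser : ∀ {c c′ : Fin k → Fin k} {W} → (∀ {x y} → c x ≡ c y → c′ x ≡ c′ y) → InjOn c′ W → InjOn c W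
  injOn-coarser coarser = AllPairs.map (λ c′x≢c′y → c′x≢c′y ∘ coarser)

  injOn-agree : ∀ {c c′ : Fin k → Fin k} {W} → All (λ x → c x ≡ c′ x) W → InjOn c W → InjOn c′ W
  injOn-agree []          []             = []
  injOn-agree (eq ∷ eqs) (x≢W ∷ inj) =
    All.zipWith (λ (cy≡c′y , cx≢cy) c′x≡c′y → cx≢cy (trans eq (trans c′x≡c′y (sym cy≡c′y)))) (eqs , x≢W) ∷ injOn-agree eqs inj

  injOn-injective : ∀ {c : Fin k → Fin k} {W x y} → InjOn c W → x ∈ˡ W → y ∈ˡ W → c x ≡ c y → x ≡ y
  injOn-injective (_ ∷ _)    (here refl) (here refl) _  = refl
  injOn-injective (x≢W ∷ _)  (here refl) (there y∈W) eq = ⊥-elim (All.lookup x≢W y∈W eq)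
  injOn-injective (y≢W ∷ _)  (there x∈W) (here refl) eq = ⊥-elim (All.lookup y≢W x∈W (sym eq))
  injOn-injective (_ ∷ inj)  (there x∈W) (there y∈W) eq = injOn-injective inj x∈W y∈W eq

  merge-trivial : ∀ (c : Fin k → Fin k) u v x → (c x ≡ c v → c u ≡ c v) → c x ≡ merge c u v x
  merge-trivial c u v x cond with c x ≟ c v
  ... | no _  = refl
  ... | yes e = trans e (sym (cond e))

  Σᴸ-unique : ∀ {c : Fin k → Fin k} {W w} → InjOn c W → w ∈ˡ W → Σᴸ W (λ u → ι (does (c u ≟ c w))) ≡ 1ℤ
  Σᴸ-unique {c} {w = w} (w≢W ∷ _) (here refl)
    rewrite dec-true (c w ≟ c w) refl = cong (1ℤ +ᶻ_) (Σᴸ-zero _ (λ {u} u∈W → cong ι (dec-false (c u ≟ c w) (All.lookup w≢W u∈W ∘ sym))))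
  Σᴸ-unique {c} {u ∷ _} {w} (u≢W ∷ inj) (there w∈W)
    rewrite dec-false (c u ≟ c w) (All.lookup u≢W w∈W) = trans (ℤ.+-identityˡ _) (Σᴸ-unique inj w∈W)

  -- Deletion–contraction: v is separated from all of W, or joined to exactly one of its members.
  Σ-merge : ∀ (c : Fin k → Fin k) v W {l} → length W ≡ suc l →
            Σᴸ W (λ u → injInd (merge c u v) W) ≡ injInd c W +ᶻ pos l *ᶻ injInd c (v ∷ W)
  Σ-merge c v W {l} len with injOn? c W
  -- If `W` is not separated to begin with, both sides vanish, because merging only coarsens.
  ... | no ¬inj = trans
    (Σᴸ-zero W (λ {u} _ → injInd-no (¬inj ∘ injOn-coarser (merge-≡ c u v))))
    (sym (trans (cong (λ b → 0ℤ +ᶻ pos l *ᶻ ι b) (∧-zeroʳ (does (All.all? (λ u → ¬? (c v ≟ c u)) W)))) (trans (ℤ.+-identityˡ _) (ℤ.*-zeroʳ (pos l)))))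
  ... | yes inj with All.all? (λ u → ¬? (c v ≟ c u)) W
  ...   | yes v≢W = begin
    Σᴸ W (λ u → injInd (merge c u v) W)
      ≡⟨ Σᴸ-cong W (λ {u} _ → injInd-yes (injOn-agree (All.map (λ {x} cv≢cx → merge-trivial c u v x (λ e → ⊥-elim (cv≢cx (sym e)))) v≢W) inj)) ⟩
    Σᴸ W (λ _ → 1ℤ)                ≡⟨ Σᴸ-one W ⟩
    pos (length W)                     ≡⟨ cong pos len ⟩
    1ℤ +ᶻ pos l                      ≡⟨ cong (1ℤ +ᶻ_) (ℤ.*-identityʳ (pos l)) ⟨
    1ℤ +ᶻ pos l *ᶻ 1ℤ                ∎
    where open ≡-Reasoning
  ...   | no ¬v≢W with find (All.¬All⇒Any¬ (λ u → ¬? (c v ≟ c u)) W ¬v≢W)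
  ...     | w , w∈W , ¬cv≢cw = begin
    Σᴸ W (λ u → injInd (merge c u v) W)           ≡⟨ Σᴸ-cong W at ⟩
    Σᴸ W (λ u → ι (does (c u ≟ c w)))        ≡⟨ Σᴸ-unique inj w∈W ⟩
    1ℤ                                       ≡⟨ cong (1ℤ +ᶻ_) (ℤ.*-zeroʳ (pos l)) ⟨
    1ℤ +ᶻ pos l *ᶻ 0ℤ                          ∎
    where
    open ≡-Reasoning
    cv≡cw : c v ≡ c w
    cv≡cw = decidable-stable (c v ≟ c w) ¬cv≢cw
    at : ∀ {u} → u ∈ˡ W → injInd (merge c u v) W ≡ ι (does (c u ≟ c w))
    at {u} u∈W with c u ≟ c w
    ... | yes cu≡cw = injInd-yes (injOn-agree (All.universal (λ x → merge-trivial c u v x (λ _ → trans cu≡cw (sym cv≡cw))) W) inj)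
    ... | no cu≢cw  = injInd-no (λ inj′ → cu≢cw (cong c (injOn-injective inj′ u∈W w∈W (trans (merge-joins c u v) (merge-≡ c u v cv≡cw)))))

-- Rank of the connectivity matrix

connected : ∀ {k} → Fin k → Fin k → List (Fin k × Fin k) → ℤ
connected s t E = ι (does (comp E s ≟ comp E t))

module _ {k N : ℕ} (s t : Fin k) (E : Fin N → List (Fin k × Fin k)) where

  -- Rows are indexed by `j`, through the edge lists `E j`; an edge list `M` names a column.
  connectivity : List (Fin k × Fin k) → Fin N → ℤ
  connectivity M j = connected s t (M ++ E j)

  separated : List (Fin k) → List (Fin k × Fin k) → Fin N → ℤ
  separated ws M j = injInd (comp (M ++ E j)) (ws ++ s ∷ t ∷ [])

  -- The added edge makes the left side the all-ones column, and in each row `s` and `t` are either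
  -- separated or connected.
  separated-[] : ∀ M j → connectivity ((s , t) ∷ M) j ≡ separated [] M j +ᶻ connectivity M j
  separated-[] M j rewrite dec-true (comp ((s , t) ∷ M ++ E j) s ≟ comp ((s , t) ∷ M ++ E j) t) (merge-joins (comp (M ++ E j)) s t)
    with comp (M ++ E j) s ≟ comp (M ++ E j) t
  ... | yes _ = refl
  ... | no _  = refl

  separated-∷ : ∀ v ws M j → Σᴸ (ws ++ s ∷ t ∷ []) (λ u → separated ws ((u , v) ∷ M) j) ≡ separated ws M j +ᶻ separated (v ∷ ws) M j *ᶻ pos (suc (length ws))
  separated-∷ v ws M j = trans
    (Σ-merge (comp (M ++ E j)) v (ws ++ s ∷ t ∷ []) (trans (length-++ ws) (+-comm (length ws) 2)))
    (cong (separated ws M j +ᶻ_) (ℤ.*-comm (pos (suc (length ws))) (separated (v ∷ ws) M j)))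

  -- The spanning claim in dual form: a functional that vanishes on all connectivity columns
  -- vanishes on all `separated` columns. The induction on `ws` uses deletion-contraction, and
  -- instead of dividing by the coefficient `suc (length ws)` it suffices that this positive integer
  -- is not a zero divisor.
  separated⇒connectivity : ∀ x ws M → dot x (separated ws M) ≢ 0ℤ → ∃ λ M′ → dot x (connectivity M′) ≢ 0ℤ
  separated⇒connectivity x [] M ≢0 with dot x (connectivity M) ℤ.≟ 0ℤ
  ... | no KM≢0  = M , KM≢0
  ... | yes KM≡0 = (s , t) ∷ M , λ eq → ≢0 (begin
    dot x (separated [] M)                   ≡⟨ ℤ.+-identityʳ _ ⟨
    dot x (separated [] M) +ᶻ 0ℤ             ≡⟨ cong (dot x (separated [] M) +ᶻ_) KM≡0 ⟨
    dot x (separated [] M) +ᶻ dot x (connectivity M)    ≡⟨ dot-+ x (separated [] M) (connectivity M) ⟨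
    dot x (λ j → separated [] M j +ᶻ connectivity M j)  ≡⟨ dot-cong x (separated-[] M) ⟨
    dot x (connectivity ((s , t) ∷ M))                  ≡⟨ eq ⟩
    0ℤ                                       ∎)
    where open ≡-Reasoning
  separated⇒connectivity x (v ∷ ws) M ≢0 with dot x (separated ws M) ℤ.≟ 0ℤ
  ... | no ≢0′  = separated⇒connectivity x ws M ≢0′
  -- As `x` kills the first term of the expansion, the sum over `u` is a nonzero multiple of the
  -- given nonzero value, so some summand, with the shorter list `ws`, is nonzero.
  ... | yes ≡0 with Σᴸ-≢0 (ws ++ s ∷ t ∷ []) (λ u → dot x (separated ws ((u , v) ∷ M))) Σ≢0
    where
    open ≡-Reasoning
    expand : Σᴸ (ws ++ s ∷ t ∷ []) (λ u → dot x (separated ws ((u , v) ∷ M))) ≡ dot x (separated (v ∷ ws) M) *ᶻ pos (suc (length ws))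
    expand = begin
      Σᴸ (ws ++ s ∷ t ∷ []) (λ u → dot x (separated ws ((u , v) ∷ M)))
        ≡⟨ dot-Σᴸ x (ws ++ s ∷ t ∷ []) (λ u → separated ws ((u , v) ∷ M)) ⟨
      dot x (λ j → Σᴸ (ws ++ s ∷ t ∷ []) (λ u → separated ws ((u , v) ∷ M) j))
        ≡⟨ dot-cong x (separated-∷ v ws M) ⟩
      dot x (λ j → separated ws M j +ᶻ separated (v ∷ ws) M j *ᶻ pos (suc (length ws)))
        ≡⟨ dot-+ x (separated ws M) (λ j → separated (v ∷ ws) M j *ᶻ pos (suc (length ws))) ⟩
      dot x (separated ws M) +ᶻ dot x (λ j → separated (v ∷ ws) M j *ᶻ pos (suc (length ws)))
        ≡⟨ cong₂ _+ᶻ_ ≡0 (dot-*ʳ x (separated (v ∷ ws) M) (pos (suc (length ws)))) ⟩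
      0ℤ +ᶻ dot x (separated (v ∷ ws) M) *ᶻ pos (suc (length ws))
        ≡⟨ ℤ.+-identityˡ _ ⟩
      dot x (separated (v ∷ ws) M) *ᶻ pos (suc (length ws)) ∎
    Σ≢0 : Σᴸ (ws ++ s ∷ t ∷ []) (λ u → dot x (separated ws ((u , v) ∷ M))) ≢ 0ℤ
    Σ≢0 Σ≡0 with ℤ.i*j≡0⇒i≡0∨j≡0 (dot x (separated (v ∷ ws) M)) (trans (sym expand) Σ≡0)
    ... | inj₁ e = ≢0 e
    ... | inj₂ ()
  ...   | u , ≢0′ = separated⇒connectivity x ws ((u , v) ∷ M) ≢0′

dot-unit : ∀ {N} (x : Fin N → ℤ) {a i} → a i ≡ 1ℤ → (∀ {j} → i ≢ j → a j ≡ 0ℤ) → dot x a ≡ x i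
dot-unit {suc N} x {a} {i} ai≡1 a≡0 = begin
  dot x a                                                          ≡⟨ ∑ᶻ.sum-remove {i = i} (λ j → x j *ᶻ a j) ⟩
  x i *ᶻ a i +ᶻ dot (x ∘ punchIn i) (a ∘ punchIn i)                ≡⟨ cong₂ _+ᶻ_ (trans (cong (x i *ᶻ_) ai≡1) (ℤ.*-identityʳ (x i))) (dot-zeroʳ (x ∘ punchIn i) (λ j → a≡0 (punchInᵢ≢i i j ∘ sym))) ⟩
  x i +ᶻ 0ℤ                                                        ≡⟨ ℤ.+-identityʳ (x i) ⟩
  x i                                                              ∎
  where open ≡-Reasoning

funToFin-cong : ∀ {m n} {f g : Fin m → Fin n} → f ≗ g → funToFin f ≡ funToFin g
funToFin-cong {zero}  f≗g = refl
funToFin-cong {suc m} f≗g = cong₂ combine (f≗g zero) (funToFin-cong (f≗g ∘ suc))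

finToFun-injective : ∀ {m n} {i j : Fin (n ^ m)} → finToFun {n} {m} i ≗ finToFun j → i ≡ j
finToFun-injective {m} {n} {i} {j} eq = trans (sym (funToFin-finToFin {m} {n} i)) (trans (funToFin-cong eq) (funToFin-finToFin {m} {n} j))

module _ {k N : ℕ} (s t : Fin k) {others : List (Fin k)}
         (unique : Unique (others ++ s ∷ t ∷ [])) (complete : ∀ v → v ∈ˡ (others ++ s ∷ t ∷ []))
         (row : Fin N → Fin k → Fin k) (row-injective : ∀ {i j} → row i ≗ row j → i ≡ j) where

  edges : Fin N → Fin N → List (Fin k × Fin k)
  edges i j = graph (row j) (row i) []

  -- With equal functions every edge is a loop, so the identity labelling respects the graph.
  separated-self : ∀ i → separated s t (edges i) others [] i ≡ 1ℤ
  separated-self i = injInd-yes {c = comp (edges i i)}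
    (injOn-agree (All.universal (λ v → sym (respects⇒comp id {edges i i} (All.tabulate⁺ (λ _ → refl)) v)) (others ++ s ∷ t ∷ [])) unique)

  -- Were all vertices separated, each edge from `row j a` to `row i a` would be a loop and the two
  -- rows would agree.
  separated-other : ∀ {i j} → i ≢ j → separated s t (edges i) others [] j ≡ 0ℤ
  separated-other {i} {j} i≢j = injInd-no {c = comp (edges i j)} (λ inj → i≢j (sym (row-injective (λ a →
    injOn-injective inj (complete (row j a)) (complete (row i a)) (All.tabulate⁻ (comp-respects (edges i j)) a)))))

  module _ {n : ℕ} (P : Protocol n) (val : Subset n → ℤ)
           (A : (Fin k → Fin k) → Oracle n) (B : (Fin k → Fin k) → List (Fin k × Fin k) → Oracle n)
           (val-run : ∀ f h M → val (run P (A f) (B h M)) ≡ connected s t (graph f h M)) where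

    -- More rows than terms give a nonzero `x` orthogonal to all of Alice's factors. Bob gets a row
    -- `i` with `x i ≢ 0ℤ`: the all-separated column is then the `i`-th unit vector, so some `M` has
    -- a connectivity column not orthogonal to `x`. If every input in this column cost at most `d`,
    -- the terms would represent the column, forcing it to be orthogonal to `x`.
    expensive-input : ∀ d → 2 ^ d < N → ∃ λ f → ∃ λ h → ∃ λ M → d < cost P (A f) (B h M)
    expensive-input d 2^d<N
      with kernel (λ i → proj₁ (List.lookup (terms val d P) i) ∘ A ∘ row) (≤-<-trans (length-terms val d P) 2^d<N)
    ... | x , (i , xi≢0) , x⊥
      with separated⇒connectivity s t (edges i) x others [] (λ eq → xi≢0 (trans (sym (dot-unit x (separated-self i) separated-other)) eq))
    ...   | M , ≢0 with any? (λ j → d <? cost P (A (row j)) (B (row i) M))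
    ...     | yes (j , d<cost) = row j , row i , M , d<cost
    ...     | no cheap = ⊥-elim (≢0 (trans
      (dot-cong x (λ j → sym (trans (eval-terms val d P _ _ (≮⇒≥ (λ d<cost → cheap (j , d<cost)))) (val-run (row j) (row i) M))))
      (dot-eval x (A ∘ row) (terms val d P) x⊥ (B (row i) M))))

-- Connectivity read off from a matroid intersection protocol

module _ {k : ℕ} (r : ℕ) (s t : Fin k) (P : Protocol ((k + k) + ((k + k) + r))) (solves : Solves P) where

  large : Subset ((k + k) + ((k + k) + r)) → ℤ
  large S = ι (does (k + k <? ∣ S ∣))

  -- The threshold `k + k` is the number of indices. A correct output is a maximum, so its size
  -- alone reveals whether `s` and `t` are connected.
  large-run : ∀ f h M → large (run P (aliceOracle r s t f) (bobOracle r s t h M)) ≡ connected s t (graph f h M)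
  large-run f h M = decide (run P (aliceOracle r s t f) (bobOracle r s t h M))
    (solves (aliceOracle r s t f) (bobOracle r s t h M) (colourOracle-isMatroid r _ s) (colourOracle-isMatroid r _ (comp M t)))
    (comp (graph f h M) s ≟ comp (graph f h M) t)
    where
    exceeds : ∀ S → IsMaxCommonIndep (aliceOracle r s t f) (bobOracle r s t h M) S →
              (∃ λ S′ → T (aliceOracle r s t f S′) × T (bobOracle r s t h M S′) × k + k < ∣ S′ ∣) → k + k < ∣ S ∣
    exceeds S (_ , _ , max) (S′ , S′∈₁ , S′∈₂ , S′-large) = <-≤-trans S′-large (max S′ S′∈₁ S′∈₂)
    decide : ∀ S → IsMaxCommonIndep (aliceOracle r s t f) (bobOracle r s t h M) S →
             (s~t? : Dec (comp (graph f h M) s ≡ comp (graph f h M) t)) → large S ≡ ι (does s~t?)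
    decide S (S∈₁ , S∈₂ , _) (no s≁t)  = cong ι (dec-false (k + k <? ∣ S ∣) (≤⇒≯ (disconnected⇒≤ r s t f h M s≁t S S∈₁ S∈₂)))
    decide S S-max           (yes s~t) = cong ι (dec-true (k + k <? ∣ S ∣) (exceeds S S-max (connected⇒> r s t f h M s~t)))

module _ (k′ : ℕ) where

  others : List (Fin (2 + k′))
  others = map (λ i → suc (suc i)) (allFin k′)

  all-unique : Unique (others ++ zero ∷ suc zero ∷ [])
  all-unique = Unique.++⁺ (Unique.map⁺ (suc-injective ∘ suc-injective) (Unique.allFin⁺ k′)) (((λ ()) ∷ []) ∷ [] ∷ []) disjoint
    where
    disjoint : ∀ {v} → ¬ (v ∈ˡ others × v ∈ˡ (zero ∷ suc zero ∷ []))
    disjoint (v∈ , here refl)         = All.lookup (All.map⁺ {P = _≢ zero} (All.universal (λ _ ()) (allFin k′))) v∈ refl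
    disjoint (v∈ , there (here refl)) = All.lookup (All.map⁺ {P = _≢ suc zero} (All.universal (λ _ ()) (allFin k′))) v∈ refl

  all-complete : ∀ v → v ∈ˡ (others ++ zero ∷ suc zero ∷ [])
  all-complete zero          = ∈-++⁺ʳ others (here refl)
  all-complete (suc zero)    = ∈-++⁺ʳ others (there (here refl))
  all-complete (suc (suc i)) = ∈-++⁺ˡ (∈-map⁺ _ (∈-allFin i))

-- Logarithmic estimates

2^⌊log₂n⌋≤n : ∀ n → 1 ≤ n → 2 ^ ⌊log₂ n ⌋ ≤ n
2^⌊log₂n⌋≤n = <-rec _ step
  where
  step : ∀ n → (∀ {m} → m < n → 1 ≤ m → 2 ^ ⌊log₂ m ⌋ ≤ m) → 1 ≤ n → 2 ^ ⌊log₂ n ⌋ ≤ n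
  step (suc zero)        rec _ = ≤-refl
  step n@(suc (suc n-2)) rec _ = begin
    2 ^ ⌊log₂ n ⌋                     ≡⟨ cong (2 ^_) (m+[n∸m]≡n {1} (⌊log₂⌋-mono-≤ {2} {n} (s≤s (s≤s z≤n)))) ⟨
    2 * 2 ^ (⌊log₂ n ⌋ ∸ 1)  ≡⟨ cong (λ l → 2 * 2 ^ l) (⌊log₂⌊n/2⌋⌋≡⌊log₂n⌋∸1 n) ⟨
    2 * 2 ^ ⌊log₂ ⌊ n /2⌋ ⌋           ≤⟨ *-monoʳ-≤ 2 (rec (⌊n/2⌋<n (suc n-2)) (s≤s z≤n)) ⟩
    2 * ⌊ n /2⌋                       ≡⟨ cong (⌊ n /2⌋ +_) (+-identityʳ ⌊ n /2⌋) ⟩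
    ⌊ n /2⌋ + ⌊ n /2⌋                 ≤⟨ +-monoʳ-≤ ⌊ n /2⌋ (⌊n/2⌋≤⌈n/2⌉ n) ⟩
    ⌊ n /2⌋ + ⌈ n /2⌉        ≡⟨ ⌊n/2⌋+⌈n/2⌉≡n n ⟩
    n                                 ∎
    where open ≤-Reasoning

⌊log₂[8*n]⌋ : ∀ n .{{_ : NonZero n}} → ⌊log₂ 8 * n ⌋ ≡ 3 + ⌊log₂ n ⌋
⌊log₂[8*n]⌋ n = begin
  ⌊log₂ 8 * n ⌋              ≡⟨ cong ⌊log₂_⌋ (solve 1 (λ n → con 8 :* n := con 2 :* (con 2 :* (con 2 :* n))) refl n) ⟩
  ⌊log₂ 2 * (2 * (2 * n)) ⌋  ≡⟨ ⌊log₂[2*b]⌋≡1+⌊log₂b⌋ (2 * (2 * n)) {{m*n≢0 2 (2 * n) {{_}} {{m*n≢0 2 n}}}} ⟩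
  1 + ⌊log₂ 2 * (2 * n) ⌋    ≡⟨ cong (1 +_) (⌊log₂[2*b]⌋≡1+⌊log₂b⌋ (2 * n) {{m*n≢0 2 n}}) ⟩
  2 + ⌊log₂ 2 * n ⌋          ≡⟨ cong (2 +_) (⌊log₂[2*b]⌋≡1+⌊log₂b⌋ n) ⟩
  3 + ⌊log₂ n ⌋              ∎
  where open ≡-Reasoning

-- Two elements for each of `k + k` indices make `k` the quotient by 4; the remainder becomes loops.
-- From `8 ≤ n` comes `k ≥ 2`, room for distinct `s` and `t`.
decompose : ∀ n → 8 ≤ n → ∃ λ k′ → ∃ λ r → let k = suc (suc k′) in r ≤ 4 × n ≡ (k + k) + ((k + k) + r)
decompose n 8≤n with n / 4 | /-monoˡ-≤ 4 8≤n | m≡m%n+[m/n]*n n 4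
... | suc (suc k′) | _ | eq = k′ , n % 4 , <⇒≤ (m%n<n n 4) ,
  trans eq (solve 2 (λ r k → r :+ k :* con 4 := (k :+ k) :+ ((k :+ k) :+ r)) refl (n % 4) (suc (suc k′)))
... | suc zero | s≤s () | _

1≤⌊log₂k⌋ : ∀ {k} → 2 ≤ k → 1 ≤ ⌊log₂ k ⌋
1≤⌊log₂k⌋ = ⌊log₂⌋-mono-≤

suc-pred-klogk : ∀ k → 2 ≤ k → suc (pred (⌊log₂ k ⌋ * k)) ≡ ⌊log₂ k ⌋ * k
suc-pred-klogk k 2≤k = suc-pred (⌊log₂ k ⌋ * k) {{>-nonZero (*-mono-≤ (1≤⌊log₂k⌋ 2≤k) (≤-trans (s≤s z≤n) 2≤k))}}

-- `k ^ k` is the number of functions, hence of rows. The exponent is one short to make the bound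
-- strict; a cost above it is at least `⌊log₂ k ⌋ * k`.
few-leaves : ∀ k → 2 ≤ k → 2 ^ pred (⌊log₂ k ⌋ * k) < k ^ k
few-leaves k 2≤k = begin-strict
  2 ^ pred (⌊log₂ k ⌋ * k) <⟨ ^-monoʳ-< 2 (s≤s (s≤s z≤n)) (≤-reflexive (suc-pred-klogk k 2≤k)) ⟩
  2 ^ (⌊log₂ k ⌋ * k)      ≡⟨ ^-*-assoc 2 ⌊log₂ k ⌋ k ⟨
  (2 ^ ⌊log₂ k ⌋) ^ k      ≤⟨ ^-monoˡ-≤ k (2^⌊log₂n⌋≤n k (≤-trans (s≤s z≤n) 2≤k)) ⟩
  k ^ k                    ∎
  where open ≤-Reasoning

-- The constant is 8 times 4: `n ≤ 8 * k` since `r ≤ 4 * k`, and the logarithm of `8 * k` is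
-- `3 + ⌊log₂ k ⌋`, at most four times `⌊log₂ k ⌋` because the latter is at least 1.
nlogn≤32klogk : ∀ k r → 2 ≤ k → r ≤ 4 → let n = (k + k) + ((k + k) + r) in n * ⌊log₂ n ⌋ ≤ 32 * (⌊log₂ k ⌋ * k)
nlogn≤32klogk k r 2≤k r≤4 = begin
  n * ⌊log₂ n ⌋            ≤⟨ *-mono-≤ n≤8k (⌊log₂⌋-mono-≤ n≤8k) ⟩
  8 * k * ⌊log₂ 8 * k ⌋    ≡⟨ cong (8 * k *_) (⌊log₂[8*n]⌋ k {{>-nonZero 1≤k}}) ⟩
  8 * k * (3 + l)          ≤⟨ *-monoʳ-≤ (8 * k) (+-monoˡ-≤ l (*-monoʳ-≤ 3 (1≤⌊log₂k⌋ 2≤k))) ⟩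
  8 * k * (3 * l + l)      ≡⟨ solve 2 (λ k l → con 8 :* k :* (con 3 :* l :+ l) := con 32 :* (l :* k)) refl k l ⟩
  32 * (l * k)             ∎
  where
  open ≤-Reasoning
  l n : ℕ
  l = ⌊log₂ k ⌋
  n = (k + k) + ((k + k) + r)
  1≤k : 1 ≤ k
  1≤k = ≤-trans (s≤s z≤n) 2≤k
  n≤8k : n ≤ 8 * k
  n≤8k = begin
    (k + k) + ((k + k) + r)      ≤⟨ +-monoʳ-≤ (k + k) (+-monoʳ-≤ (k + k) (≤-trans r≤4 (*-monoʳ-≤ 4 1≤k))) ⟩
    (k + k) + ((k + k) + 4 * k)  ≡⟨ solve 1 (λ k → (k :+ k) :+ ((k :+ k) :+ con 4 :* k) := con 8 :* k) refl k ⟩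
    8 * k                        ∎

theorem8p1 : ∃ λ (c : ℕ) → ∃ λ (N : ℕ) → ∀ (n : ℕ) → N ≤ n →
    (P : Protocol n) → Solves P →
    ∃ λ (I₁ : Oracle n) → ∃ λ (I₂ : Oracle n) →
    IsMatroid I₁ × IsMatroid I₂ × n * ⌊log₂ n ⌋ ≤ c * cost P I₁ I₂
theorem8p1 = 32 , 8 , bound
  where
  bound : ∀ n → 8 ≤ n → (P : Protocol n) → Solves P →
          ∃ λ (I₁ : Oracle n) → ∃ λ (I₂ : Oracle n) → IsMatroid I₁ × IsMatroid I₂ × n * ⌊log₂ n ⌋ ≤ 32 * cost P I₁ I₂
  bound n 8≤n P solves with decompose n 8≤n
  ... | k′ , r , r≤4 , refl = pick (expensive-input s t (all-unique k′) (all-complete k′) (finToFun {k} {k}) (finToFun-injective {k} {k})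
          P (large r s t P solves) (aliceOracle r s t) (bobOracle r s t) (large-run r s t P solves) (pred (⌊log₂ k ⌋ * k)) (few-leaves k 2≤k))
    where
    k : ℕ
    k = 2 + k′
    s t : Fin k
    s = zero
    t = suc zero
    2≤k : 2 ≤ k
    2≤k = s≤s (s≤s z≤n)
    pick : (∃ λ f → ∃ λ h → ∃ λ M → pred (⌊log₂ k ⌋ * k) < cost P (aliceOracle r s t f) (bobOracle r s t h M)) →
           ∃ λ I₁ → ∃ λ I₂ → IsMatroid I₁ × IsMatroid I₂ × n * ⌊log₂ n ⌋ ≤ 32 * cost P I₁ I₂
    pick (f , h , M , lt) = aliceOracle r s t f , bobOracle r s t h M
      , colourOracle-isMatroid r _ s , colourOracle-isMatroid r _ (comp M t)
      , ≤-trans (nlogn≤32klogk k r 2≤k r≤4) (*-monoʳ-≤ 32 (subst (_≤ cost P (aliceOracle r s t f) (bobOracle r s t h M)) (suc-pred-klogk k 2≤k) lt))
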